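{- Let $r\geq 3$ be an integer. For every $\epsilon>0$ and every $\delta>0$, there exists $n_0\in\mathbb N$ such that for all integers $n$ and $k$ with $n>n_0$ and $\frac{r-2}{r-1}+\epsilon<\frac kn<\frac{r-1}r-\epsilon$, we have $$(1-\delta)\binom{n-1}{k-1}\leq M_r(n,k)<\binom{n-1}{k-1}.$$
   Context: Let $[n]=\{1,2,\ldots,n\}$ and $\binom{[n]}{k}=\{F\subset[n]:|F|=k\}$. A family $\mathcal F\subset\binom{[n]}{k}$ is $r$-wise intersecting if $F_1\cap\cdots\cap F_r\neq\emptyset$ for all $F_1,\ldots,F_r\in\mathcal F$ (not necessarily distinct); it is non-trivial if $\bigcap_{F\in\mathcal F}F=\emptyset$. $M_r(n,k)$ denotes the maximum size $|\mathcal F|$ of a non-trivial $r$-wise intersecting family $\mathcal F\subset\binom{[n]}{k}$. -}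

module Defs where

open import Data.Fin using (Fin)
open import Data.Fin.Subset using (Subset; ∣_∣; ⋂; Nonempty; Empty)
open import Data.List using (List; length; tabulate)
open import Data.List.Membership.Propositional using (_∈_)
open import Data.List.Relation.Unary.All using (All)
open import Data.List.Relation.Unary.Unique.Propositional using (Unique)
open import Data.Nat using (ℕ; _≤_; _<_; _∸_; NonZero; >-nonZero; s≤s)
open import Data.Nat.Properties using (m<n⇒0<n)
open import Data.Product using (_×_; ∃-syntax)
open import Relation.Binary.PropositionalEquality using (_≡_)

-- The ground set {1, …, n} is represented by Fin n.  Families are finite
-- sets of subsets, so they are given by duplicate-free lists.
record Family (n k : ℕ) : Set where
  field
    members : List (Subset n)
    unique  : Unique members
    uniform : All (λ F → ∣ F ∣ ≡ k) members

open Family public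

size : ∀ {n k} → Family n k → ℕ
size 𝓕 = length (members 𝓕)

Intersecting : ∀ {n k} → ℕ → Family n k → Set
Intersecting {n} r 𝓕 =
  (F : Fin r → Subset n) → (∀ i → F i ∈ members 𝓕) → Nonempty (⋂ (tabulate F))

-- ⋂ [] is the whole ground set.
NonTrivial : ∀ {n k} → Family n k → Set
NonTrivial 𝓕 = Empty (⋂ (members 𝓕))

-- M r n k ≡ m, as a relation: the maximum is undefined when there is no
-- non-trivial r-wise intersecting family at all.
IsM : (r n k m : ℕ) → Set
IsM r n k m =
  (∃[ 𝓕 ] Admissible 𝓕 × size 𝓕 ≡ m) × (∀ 𝓕 → Admissible 𝓕 → size 𝓕 ≤ m)
  where
  Admissible : Family n k → Set
  Admissible 𝓕 = Intersecting r 𝓕 × NonTrivial 𝓕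

>⇒nonZero : ∀ {m n} → m < n → NonZero n
>⇒nonZero m<n = >-nonZero (m<n⇒0<n m<n)

3≤⇒nonZero : ∀ {r} → 3 ≤ r → NonZero r
3≤⇒nonZero = >⇒nonZero

3≤⇒pred-nonZero : ∀ {r} → 3 ≤ r → NonZero (r ∸ 1)
3≤⇒pred-nonZero (s≤s 2≤r) = >⇒nonZero 2≤r

{-# OPTIONS --safe #-}
module Submission where

-- Upper bound: in a cyclic arrangement of the ground set, let A be the set of starting points of the l-arcs, l = n − k,
-- whose complements lie in the family.  No r of these arcs cover the circle, and comparing with arcs of length
-- ⌈n / r⌉ < l gives |A| ≤ k; moreover equality forces A to be an interval, so that the complements in the family are
-- exactly the k-arcs through one point.  Averaging over all arrangements, as Katona does, gives the bound
-- C(n − 1, k − 1).  If it is attained then every arrangement is extremal, and since exchanging two neighbours cannot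
-- move the common point, the family is a star, hence trivial.
--
-- Lower bound: fix a k-set I avoiding the point 0, and take I together with all k-sets F containing 0 such that
-- |I ∖ F| < k / (r − 1).  At most r − 1 members other than I cannot empty I, so the family is r-wise intersecting, and
-- it is non-trivial.  As |I ∖ F| has mean about k (n − k) / n, which is smaller than k / (r − 1) by a constant
-- fraction, Chebyshev's inequality shows that all but a δ-fraction of the k-sets through 0 qualify.

open import Data.Nat using (ℕ; _∸_) renaming (_≤_ to _≤ℕ_; _<_ to _<ℕ_)
open import Data.Nat.Combinatorics using (_C_)
open import Data.Product using (_×_; ∃-syntax)
open import Defs

-- The two bounds on `k / n` enter at different places. The upper one puts `l` strictly above ⌈n /
-- r⌉. Strictness matters: it leaves at least one step of shortening the arcs, and the loss in that
-- step counts the maximal intervals of A, so the equality case comes out of the same computation as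
-- the bound. The code follows the complement of A (`b`, later `miss`), which loses points when it
-- is eroded.
--
-- The lower bound puts the mean of |I ∖ F| below k / (r - 1). Together with `r ≥ 3` it also gives
-- `n < 2 * k`, that is `l < k`, and this makes exchanges rigid: an exchange of neighbours affects
-- only two arcs, the one that starts and the one that ends between the two places, and with `l < k`
-- an actual change would split the interval A in two, which extremality of the new arrangement
-- forbids.
--
-- Counting is done over ℕ, with subtractions moved across and denominators cleared; rationals
-- appear only at the end.

module FiniteFamilies where

  open import Data.Bool using (Bool; true; false; not; if_then_else_; _∧_)
  open import Data.Bool.Properties as Bool using (T-≡; ¬-not; not-injective; not-involutive)
  import Data.Empty as Empty
  open import Data.Fin as Fin using (Fin; zero; suc; toℕ; fromℕ<)
  open import Data.Fin.Properties using (any?; toℕ<n; toℕ-fromℕ<)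
  open import Data.Fin.Subset as Subset using (Subset; ∣_∣; inside; outside; _∩_; _∪_; ∁; ⁅_⁆; ⊤; ⊥; ⋂; Nonempty)
  open import Data.Fin.Subset.Properties renaming (_∈?_ to _∈ˢ?_)
  open import Data.List using (List; []; _∷_; [_]; map; length; _++_; _∷ʳ_; concatMap; downFrom; allFin; tabulate; filter; InitLast; initLast; _∷ʳ′_)
  open import Data.List.Properties using (map-tabulate; map-++; length-map; length-++; length-tabulate; length-downFrom; ++-assoc; ∷ʳ-++)
  import Data.List.Membership.DecPropositional as DecMembership
  open import Data.List.Membership.Propositional using (_∈_; find)
  open import Data.List.Membership.Propositional.Properties
  open import Data.List.Relation.Binary.Permutation.Propositional as Perm using (_↭_; prep; swap; ↭-refl; ↭-sym; ↭-trans; ↭-reflexive; ↭⇒↭ₛ)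
  open import Data.List.Relation.Binary.Permutation.Propositional.Properties using (shift; ++⁺ˡ; ++⁺ʳ; ∷↭∷ʳ; drop-∷; ∈-resp-↭; ↭-length; map⁺)
  import Data.List.Relation.Binary.Permutation.Setoid.Properties as Permutationₛ
  open import Data.List.Relation.Unary.All as All using (All; []; _∷_)
  import Data.List.Relation.Unary.All.Properties as All
  open import Data.List.Relation.Unary.AllPairs using ([]; _∷_)
  open import Data.List.Relation.Unary.Any as Any using (here; there)
  open import Data.List.Relation.Unary.Unique.Propositional using (Unique)
  import Data.List.Relation.Unary.Unique.Propositional.Properties as Unique
  open import Data.Nat using (ℕ; zero; suc; _+_; _*_; _∸_; _/_; _%_; _!; _≤_; _<_; z≤n; s≤s; s≤s⁻¹; _<ᵇ_; _≤?_; _<?_; >-nonZero)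
  open import Data.Nat.Combinatorics using (nCk+nC[k+1]≡[n+1]C[k+1]; nC1≡n; k>n⇒nCk≡0; nCk≡nC[n∸k])
  open import Data.Nat.DivMod using (m≡m%n+[m/n]*n; m%n<n; m<n⇒m%n≡m; [m+kn]%n≡m%n; m<n*o⇒m/o<n; m/n*n≤m)
  open import Data.Nat.Properties
  open import Data.List.Extrema ≤-totalOrder using (argmax; argmax-all; f[xs]≤f[argmax])
  open import Data.Nat.Tactic.RingSolver using (solve-∀)
  open import Data.Product using (_,_; proj₁; proj₂)
  open import Data.Sum using (_⊎_; inj₁; inj₂)
  open import Data.Vec as Vec using ([]; _∷_)
  import Data.Vec.Properties as Vec
  open import Function using (_∘_; id; Equivalence)
  open import Relation.Binary.Definitions using (DecidableEquality)
  open import Relation.Binary.PropositionalEquality hiding ([_]; J)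
  open import Relation.Nullary using (¬_; Dec; yes; no; does; contradiction; ¬?; _×-dec_)
  open import Relation.Nullary.Decidable using (map′; dec-true; dec-false; decidable-stable)
  open import Relation.Unary using (Decidable)

  -- Sums over lists and counting

  private variable
    A B : Set

  ∑ : List A → (A → ℕ) → ℕ
  ∑ []       f = 0
  ∑ (x ∷ xs) f = f x + ∑ xs f

  syntax ∑ xs (λ x → e) = ∑[ x ∈ xs ] e

  ∑-cong∈ : ∀ (xs : List A) {f g : A → ℕ} → (∀ {x} → x ∈ xs → f x ≡ g x) → ∑ xs f ≡ ∑ xs g
  ∑-cong∈ []       eq = refl
  ∑-cong∈ (x ∷ xs) eq = cong₂ _+_ (eq (here refl)) (∑-cong∈ xs (eq ∘ there))

  ∑-cong : ∀ (xs : List A) {f g : A → ℕ} → (∀ x → f x ≡ g x) → ∑ xs f ≡ ∑ xs g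
  ∑-cong xs eq = ∑-cong∈ xs (λ {x} _ → eq x)

  ∑-mono∈ : ∀ (xs : List A) {f g : A → ℕ} → (∀ {x} → x ∈ xs → f x ≤ g x) → ∑ xs f ≤ ∑ xs g
  ∑-mono∈ []       le = z≤n
  ∑-mono∈ (x ∷ xs) le = +-mono-≤ (le (here refl)) (∑-mono∈ xs (le ∘ there))

  -- The equality case of averaging: it turns extremality of the family into extremality of every
  -- single arrangement.
  ∑-tight : ∀ (xs : List A) {f g : A → ℕ} → (∀ {x} → x ∈ xs → f x ≤ g x) → ∑ xs g ≤ ∑ xs f →
            ∀ {x} → x ∈ xs → g x ≤ f x
  ∑-tight (x ∷ xs) {f} {g} le ge (here refl) = +-cancelʳ-≤ (∑ xs f) (g x) (f x)
    (≤-trans (+-monoʳ-≤ (g x) (∑-mono∈ xs (le ∘ there))) ge)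
  ∑-tight (x ∷ xs) {f} {g} le ge (there x∈) = ∑-tight xs (le ∘ there)
    (+-cancelˡ-≤ (f x) _ _ (≤-trans (+-monoˡ-≤ (∑ xs g) (le (here refl))) ge)) x∈

  ∑-+ : ∀ (xs : List A) (f g : A → ℕ) → ∑[ x ∈ xs ] (f x + g x) ≡ ∑ xs f + ∑ xs g
  ∑-+ []       f g = refl
  ∑-+ (x ∷ xs) f g rewrite ∑-+ xs f g = lem (f x) (g x) (∑ xs f) (∑ xs g)
    where
    lem : ∀ a b c d → a + b + (c + d) ≡ a + c + (b + d)
    lem = solve-∀

  ∑-*ˡ : ∀ (xs : List A) c (f : A → ℕ) → ∑[ x ∈ xs ] (c * f x) ≡ c * ∑ xs f
  ∑-*ˡ []       c f = sym (*-zeroʳ c)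
  ∑-*ˡ (x ∷ xs) c f = trans (cong (c * f x +_) (∑-*ˡ xs c f)) (sym (*-distribˡ-+ c (f x) (∑ xs f)))

  ∑-const : ∀ (xs : List A) c → ∑[ x ∈ xs ] c ≡ length xs * c
  ∑-const []       c = refl
  ∑-const (x ∷ xs) c = cong (c +_) (∑-const xs c)

  ∑-++ : ∀ (xs ys : List A) (f : A → ℕ) → ∑ (xs ++ ys) f ≡ ∑ xs f + ∑ ys f
  ∑-++ []       ys f = refl
  ∑-++ (x ∷ xs) ys f = trans (cong (f x +_) (∑-++ xs ys f)) (sym (+-assoc (f x) _ _))

  ∑-map : ∀ (h : A → B) xs (f : B → ℕ) → ∑ (map h xs) f ≡ ∑ xs (f ∘ h)
  ∑-map h []       f = refl
  ∑-map h (x ∷ xs) f = cong (f (h x) +_) (∑-map h xs f)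

  ∑-concatMap : ∀ (h : A → List B) xs (f : B → ℕ) → ∑ (concatMap h xs) f ≡ ∑[ x ∈ xs ] ∑ (h x) f
  ∑-concatMap h []       f = refl
  ∑-concatMap h (x ∷ xs) f = trans (∑-++ (h x) _ f) (cong (∑ (h x) f +_) (∑-concatMap h xs f))

  ∑-swap : ∀ (xs : List A) (ys : List B) (f : A → B → ℕ) →
           ∑[ x ∈ xs ] ∑[ y ∈ ys ] f x y ≡ ∑[ y ∈ ys ] ∑[ x ∈ xs ] f x y
  ∑-swap []       ys f = sym (trans (∑-const ys 0) (*-zeroʳ (length ys)))
  ∑-swap (x ∷ xs) ys f = trans (cong (∑ ys (f x) +_) (∑-swap xs ys f))
    (sym (∑-+ ys (f x) (λ y → ∑[ x ∈ xs ] f x y)))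

  ∑-downFrom-suc : ∀ n (f : ℕ → ℕ) → ∑ (downFrom (suc n)) f ≡ f 0 + ∑ (downFrom n) (f ∘ suc)
  ∑-downFrom-suc zero    f = refl
  ∑-downFrom-suc (suc n) f = begin
    f (suc n) + ∑ (downFrom (suc n)) f             ≡⟨ cong (f (suc n) +_) (∑-downFrom-suc n f) ⟩
    f (suc n) + (f 0 + ∑ (downFrom n) (f ∘ suc))   ≡⟨ lem (f (suc n)) (f 0) _ ⟩
    f 0 + (f (suc n) + ∑ (downFrom n) (f ∘ suc))   ∎
    where
    open ≡-Reasoning
    lem : ∀ a b c → a + (b + c) ≡ b + (a + c)
    lem = solve-∀

  𝟙 : Bool → ℕ
  𝟙 b = if b then 1 else 0

  count : ℕ → (ℕ → Bool) → ℕ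
  count n P = ∑[ i ∈ downFrom n ] 𝟙 (P i)

  count-not : ∀ n P → count n P + count n (not ∘ P) ≡ n
  count-not zero    P = refl
  count-not (suc n) P with P n
  ... | true  = cong suc (count-not n P)
  ... | false = trans (+-suc _ _) (cong suc (count-not n P))

  -- Averaging over arrangements

  kSubsets : ∀ n → ℕ → List (Subset n)
  kSubsets zero    zero    = [] ∷ []
  kSubsets zero    (suc k) = []
  kSubsets (suc n) zero    = map (outside ∷_) (kSubsets n zero)
  kSubsets (suc n) (suc k) = map (inside ∷_) (kSubsets n k) ++ map (outside ∷_) (kSubsets n (suc k))

  select : List A → List (A × List A)
  select []       = []
  select (x ∷ xs) = (x , xs) ∷ map (λ (y , r) → y , x ∷ r) (select xs)

  -- The number is fuel, meant to be the length of the list: `select` removes an entry anywhere, so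
  -- recursion on the list would not be structural.
  arrangements : ℕ → List A → List (List A)
  arrangements zero    xs = [] ∷ []
  arrangements (suc n) xs = concatMap (λ (y , r) → map (y ∷_) (arrangements n r)) (select xs)

  select-↭ : ∀ {y : A} {r} xs → (y , r) ∈ select xs → xs ↭ y ∷ r
  select-↭ (x ∷ xs) (here refl) = ↭-refl
  select-↭ (x ∷ xs) (there p) with ∈-map⁻ _ p
  ... | (y , r) , q , refl = ↭-trans (prep x (select-↭ xs q)) (swap x y ↭-refl)

  ∈-select : ∀ {y : A} {xs} → y ∈ xs → ∃[ r ] (y , r) ∈ select xs
  ∈-select (here refl) = _ , here refl
  ∈-select (there p) with ∈-select p
  ... | r , q = _ , there (∈-map⁺ _ q)

  ∈-arrangements⁻ : ∀ n {xs π : List A} → length xs ≡ n → π ∈ arrangements n xs → π ↭ xs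
  ∈-arrangements⁻ zero    {[]}     len (here refl) = ↭-refl
  ∈-arrangements⁻ (suc n) {xs} len p 
    with find (∈-concatMap⁻ (λ (y , r) → map (y ∷_) (arrangements n r)) {xs = select xs} p)
  ... | (y , r) , yr∈ , q′ with ∈-map⁻ (y ∷_) q′
  ... | π′ , π′∈ , refl = ↭-sym (↭-trans (select-↭ xs yr∈) (prep y (↭-sym (∈-arrangements⁻ n (suc-injective (trans (sym (↭-length (select-↭ xs yr∈))) len)) π′∈))))

  ∈-arrangements⁺ : ∀ n {xs π : List A} → length xs ≡ n → π ↭ xs → π ∈ arrangements n xs
  ∈-arrangements⁺ zero    {[]} {[]}    len eq = here refl
  ∈-arrangements⁺ zero    {[]} {x ∷ π} len eq with () ← ↭-length eq
  ∈-arrangements⁺ (suc n) {xs} {[]}    len eq with () ← trans (↭-length eq) len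
  ∈-arrangements⁺ (suc n) {xs} {y ∷ π} len eq with ∈-select (∈-resp-↭ eq (here refl))
  ... | r , yr∈ = ∈-concatMap⁺ _ (Any.map (λ { refl → ∈-map⁺ (y ∷_) (∈-arrangements⁺ n
      (suc-injective (trans (sym (↭-length (select-↭ xs yr∈))) len))
      (drop-∷ (↭-trans eq (select-↭ xs yr∈)))) }) yr∈)

  module _ {N : ℕ} where

    insertIf : Bool → Fin N → Subset N → Subset N
    insertIf true  x S = ⁅ x ⁆ ∪ S
    insertIf false x S = S

    elementsAt : (ℕ → Bool) → List (Fin N) → Subset N
    elementsAt P []       = ⊥
    elementsAt P (x ∷ xs) = insertIf (P 0) x (elementsAt (P ∘ suc) xs)

    -- Ranges over the k-element sublists of a list instead of `kSubsets`, because removing an entry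
    -- with `select` leaves a list, not a smaller ground set.
    ∑Sub : List (Fin N) → ℕ → (Subset N → ℕ) → ℕ
    ∑Sub []       zero    g = g ⊥
    ∑Sub []       (suc k) g = 0
    ∑Sub (x ∷ xs) zero    g = ∑Sub xs zero g
    ∑Sub (x ∷ xs) (suc k) g = ∑Sub xs k (g ∘ (⁅ x ⁆ ∪_)) + ∑Sub xs (suc k) g

    ∑Sub-cong : ∀ xs k {g h : Subset N → ℕ} → (∀ S → g S ≡ h S) → ∑Sub xs k g ≡ ∑Sub xs k h
    ∑Sub-cong []       zero    eq = eq ⊥
    ∑Sub-cong []       (suc k) eq = refl
    ∑Sub-cong (x ∷ xs) zero    eq = ∑Sub-cong xs zero eq
    ∑Sub-cong (x ∷ xs) (suc k) eq = cong₂ _+_ (∑Sub-cong xs k (eq ∘ _)) (∑Sub-cong xs (suc k) eq)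

    ∪-swap : ∀ (p q r : Subset N) → p ∪ (q ∪ r) ≡ q ∪ (p ∪ r)
    ∪-swap p q r = trans (sym (∪-assoc p q r)) (trans (cong (_∪ r) (∪-comm p q)) (∪-assoc q p r))

    -- Each sublist of length `suc k` arises once for each of its entries, singled out as `y`.
    ∑-select-in : ∀ xs k g → ∑[ (y , r) ∈ select xs ] ∑Sub r k (g ∘ (⁅ y ⁆ ∪_)) ≡ suc k * ∑Sub xs (suc k) g
    ∑-select-in []       k       g = sym (*-zeroʳ (suc k))
    ∑-select-in (x ∷ xs) zero    g = begin
      ∑Sub xs 0 gx + ∑ (map _ (select xs)) _   ≡⟨ cong (∑Sub xs 0 gx +_) (∑-map _ (select xs) _) ⟩
      ∑Sub xs 0 gx + ∑[ (y , r) ∈ select xs ] ∑Sub r 0 (g ∘ (⁅ y ⁆ ∪_)) ≡⟨ cong (∑Sub xs 0 gx +_) (∑-select-in xs 0 g) ⟩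
      ∑Sub xs 0 gx + 1 * ∑Sub xs 1 g           ≡⟨ lem (∑Sub xs 0 gx) _ ⟩
      1 * (∑Sub xs 0 gx + ∑Sub xs 1 g)         ∎
      where
      open ≡-Reasoning
      gx = g ∘ (⁅ x ⁆ ∪_)
      lem : ∀ a b → a + 1 * b ≡ 1 * (a + b)
      lem = solve-∀
    ∑-select-in (x ∷ xs) (suc k) g = begin
      U + ∑ (map _ (select xs)) _
        ≡⟨ cong (U +_) (∑-map _ (select xs) _) ⟩
      U + ∑[ (y , r) ∈ select xs ] (∑Sub r k (g ∘ (⁅ y ⁆ ∪_) ∘ (⁅ x ⁆ ∪_)) + ∑Sub r (suc k) (g ∘ (⁅ y ⁆ ∪_)))
        ≡⟨ cong (U +_) (∑-+ (select xs) _ _) ⟩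
      U + (∑[ (y , r) ∈ select xs ] ∑Sub r k (g ∘ (⁅ y ⁆ ∪_) ∘ (⁅ x ⁆ ∪_)) + ∑[ (y , r) ∈ select xs ] ∑Sub r (suc k) (g ∘ (⁅ y ⁆ ∪_)))
        ≡⟨ cong (λ s → U + (s + ∑[ (y , r) ∈ select xs ] ∑Sub r (suc k) (g ∘ (⁅ y ⁆ ∪_))))
             (∑-cong (select xs) (λ (y , r) → ∑Sub-cong r k (λ S → cong g (∪-swap ⁅ y ⁆ ⁅ x ⁆ S)))) ⟩
      U + (∑[ (y , r) ∈ select xs ] ∑Sub r k (gx ∘ (⁅ y ⁆ ∪_)) + ∑[ (y , r) ∈ select xs ] ∑Sub r (suc k) (g ∘ (⁅ y ⁆ ∪_)))
        ≡⟨ cong₂ (λ s t → U + (s + t)) (∑-select-in xs k gx) (∑-select-in xs (suc k) g) ⟩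
      U + (suc k * U + suc (suc k) * ∑Sub xs (suc (suc k)) g)
        ≡⟨ lem k U _ ⟩
      suc (suc k) * (U + ∑Sub xs (suc (suc k)) g) ∎
      where
      open ≡-Reasoning
      gx = g ∘ (⁅ x ⁆ ∪_)
      U = ∑Sub xs (suc k) gx
      lem : ∀ k a b → a + (suc k * a + suc (suc k) * b) ≡ suc (suc k) * (a + b)
      lem = solve-∀

    -- A sublist of length `k` survives the removal of any of the `length xs − k` entries outside
    -- it; the negative term stands on the left.
    ∑-select-out : ∀ xs k g → ∑[ (y , r) ∈ select xs ] ∑Sub r k g + k * ∑Sub xs k g ≡ length xs * ∑Sub xs k g
    ∑-select-out []       zero    g = refl
    ∑-select-out []       (suc k) g = *-zeroʳ k
    ∑-select-out (x ∷ xs) zero    g = begin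
      U + ∑ (map _ (select xs)) _ + 0  ≡⟨ cong (λ s → U + s + 0) (∑-map _ (select xs) _) ⟩
      U + ∑[ (y , r) ∈ select xs ] ∑Sub r 0 g + 0  ≡⟨ +-assoc U _ 0 ⟩
      U + (∑[ (y , r) ∈ select xs ] ∑Sub r 0 g + 0)  ≡⟨ cong (U +_) (∑-select-out xs 0 g) ⟩
      U + length xs * U ∎
      where
      open ≡-Reasoning
      U = ∑Sub xs 0 g
    ∑-select-out (x ∷ xs) (suc k) g = begin
      V + ∑ (map _ (select xs)) _ + suc k * (U + V)  ≡⟨ cong (λ s → V + s + suc k * (U + V)) (trans (∑-map _ (select xs) _) (∑-+ (select xs) _ _)) ⟩
      V + (Σ₁ + Σ₂) + suc k * (U + V)  ≡⟨ lem k U V Σ₁ Σ₂ ⟩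
      U + V + ((Σ₁ + k * U) + (Σ₂ + suc k * V)) ≡⟨ cong₂ (λ s t → U + V + (s + t)) (∑-select-out xs k gx) (∑-select-out xs (suc k) g) ⟩
      U + V + (length xs * U + length xs * V) ≡⟨ cong (U + V +_) (sym (*-distribˡ-+ (length xs) U V)) ⟩
      U + V + length xs * (U + V) ∎
      where
      open ≡-Reasoning
      gx = g ∘ (⁅ x ⁆ ∪_)
      U = ∑Sub xs k gx
      V = ∑Sub xs (suc k) g
      Σ₁ = ∑[ (y , r) ∈ select xs ] ∑Sub r k gx
      Σ₂ = ∑[ (y , r) ∈ select xs ] ∑Sub r (suc k) g
      lem : ∀ k u v s t → v + (s + t) + suc k * (u + v) ≡ u + v + ((s + k * u) + (t + suc k * v))
      lem = solve-∀

    -- Split off the first entry. If position 0 is selected, the entry joins the set and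
    -- `∑-select-in` supplies a factor of `k !`; otherwise `∑-select-out` supplies a factor of
    -- `l !`. This is the uniformity on which Katona's averaging rests.
    ∑-arrangements : ∀ n xs P k l (g : Subset N → ℕ) → length xs ≡ n → count n P ≡ k → count n (not ∘ P) ≡ l →
                     ∑[ π ∈ arrangements n xs ] g (elementsAt P π) ≡ k ! * l ! * ∑Sub xs k g
    ∑-arrangements zero [] P zero zero g refl refl refl = refl
    ∑-arrangements (suc n) xs P k l g len ck cl = trans
      (trans (∑-concatMap _ (select xs) _) (∑-cong (select xs) (λ (y , r) → ∑-map (y ∷_) (arrangements n r) _)))
      (step (P 0) refl k l (trans (sym (∑-downFrom-suc n (𝟙 ∘ P))) ck) (trans (sym (∑-downFrom-suc n (𝟙 ∘ not ∘ P))) cl))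
      where
      open ≡-Reasoning
      P′ = P ∘ suc
      rlen : ∀ {y r} → (y , r) ∈ select xs → length r ≡ n
      rlen yr∈ = suc-injective (trans (sym (↭-length (select-↭ xs yr∈))) len)
      step : ∀ b → P 0 ≡ b → ∀ k l → 𝟙 b + count n P′ ≡ k → 𝟙 (not b) + count n (not ∘ P′) ≡ l →
        ∑[ (y , r) ∈ select xs ] ∑[ π ∈ arrangements n r ] g (insertIf b y (elementsAt P′ π)) ≡ k ! * l ! * ∑Sub xs k g
      step true  eq (suc k) l ek el = begin
        _ ≡⟨ ∑-cong∈ (select xs) (λ {(y , r)} yr∈ → ∑-arrangements n r P′ k l (g ∘ (⁅ y ⁆ ∪_)) (rlen yr∈) (suc-injective ek) el) ⟩
        _ ≡⟨ ∑-*ˡ (select xs) (k ! * l !) _ ⟩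
        k ! * l ! * (∑[ (y , r) ∈ select xs ] ∑Sub r k (g ∘ (⁅ y ⁆ ∪_))) ≡⟨ cong (k ! * l ! *_) (∑-select-in xs k g) ⟩
        k ! * l ! * (suc k * ∑Sub xs (suc k) g) ≡⟨ lem (k !) (l !) (suc k) _ ⟩
        suc k * k ! * l ! * ∑Sub xs (suc k) g ∎
        where
        lem : ∀ a b c d → a * b * (c * d) ≡ c * a * b * d
        lem = solve-∀
      step false eq k (suc l) ek el = begin
        _ ≡⟨ ∑-cong∈ (select xs) (λ {(y , r)} yr∈ → ∑-arrangements n r P′ k l g (rlen yr∈) ek (suc-injective el)) ⟩
        _ ≡⟨ ∑-*ˡ (select xs) (k ! * l !) _ ⟩
        k ! * l ! * (∑[ (y , r) ∈ select xs ] ∑Sub r k g) ≡⟨ cong (k ! * l ! *_) out ⟩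
        k ! * l ! * (suc l * ∑Sub xs k g) ≡⟨ lem (k !) (l !) (suc l) _ ⟩
        k ! * (suc l * l !) * ∑Sub xs k g ∎
        where
        lem : ∀ a b c d → a * b * (c * d) ≡ a * (c * b) * d
        lem = solve-∀
        n≡ : length xs ≡ suc l + k
        n≡ = trans len (trans (cong suc (trans (sym (count-not n P′)) (cong₂ _+_ ek (suc-injective el)))) (cong suc (+-comm k l)))
        out : ∑[ (y , r) ∈ select xs ] ∑Sub r k g ≡ suc l * ∑Sub xs k g
        out = +-cancelʳ-≡ (k * ∑Sub xs k g) _ _ (trans (∑-select-out xs k g)
                (trans (cong (_* ∑Sub xs k g) n≡) (*-distribʳ-+ (∑Sub xs k g) (suc l) k)))

  ∑Sub-suc : ∀ {N} xs k (g : Subset (suc N) → ℕ) → ∑Sub (map suc xs) k g ≡ ∑Sub {N} xs k (g ∘ (outside ∷_))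
  ∑Sub-suc []       zero    g = refl
  ∑Sub-suc []       (suc k) g = refl
  ∑Sub-suc (x ∷ xs) zero    g = ∑Sub-suc xs zero g
  ∑Sub-suc (x ∷ xs) (suc k) g = cong₂ _+_ (∑Sub-suc xs k _) (∑Sub-suc xs (suc k) g)

  ∑Sub-allFin : ∀ N k (g : Subset N → ℕ) → ∑Sub (allFin N) k g ≡ ∑ (kSubsets N k) g
  ∑Sub-allFin zero    zero    g = sym (+-identityʳ _)
  ∑Sub-allFin zero    (suc k) g = refl
  ∑Sub-allFin (suc N) zero    g rewrite sym (map-tabulate {n = N} id Fin.suc) = trans (∑Sub-suc (allFin N) zero g)
    (trans (∑Sub-allFin N zero _) (sym (∑-map (outside ∷_) (kSubsets N zero) g)))
  ∑Sub-allFin (suc N) (suc k) g rewrite sym (map-tabulate {n = N} id Fin.suc) = begin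
    ∑Sub (map suc (allFin N)) k (g ∘ (⁅ zero ⁆ ∪_)) + ∑Sub (map suc (allFin N)) (suc k) g
      ≡⟨ cong₂ _+_ (∑Sub-suc (allFin N) k _) (∑Sub-suc (allFin N) (suc k) g) ⟩
    ∑Sub (allFin N) k (λ S → g (inside ∷ (⊥ ∪ S))) + ∑Sub (allFin N) (suc k) (g ∘ (outside ∷_))
      ≡⟨ cong₂ _+_ (∑Sub-cong (allFin N) k (λ S → cong (g ∘ (inside ∷_)) (∪-identityˡ S))) refl ⟩
    ∑Sub (allFin N) k (g ∘ (inside ∷_)) + ∑Sub (allFin N) (suc k) (g ∘ (outside ∷_))
      ≡⟨ cong₂ _+_ (∑Sub-allFin N k _) (∑Sub-allFin N (suc k) _) ⟩
    ∑ (kSubsets N k) (g ∘ (inside ∷_)) + ∑ (kSubsets N (suc k)) (g ∘ (outside ∷_))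
      ≡⟨ sym (cong₂ _+_ (∑-map (inside ∷_) (kSubsets N k) g) (∑-map (outside ∷_) (kSubsets N (suc k)) g)) ⟩
    ∑ (map (inside ∷_) (kSubsets N k)) g + ∑ (map (outside ∷_) (kSubsets N (suc k))) g
      ≡⟨ sym (∑-++ (map (inside ∷_) (kSubsets N k)) _ g) ⟩
    ∑ (kSubsets (suc N) (suc k)) g ∎
    where open ≡-Reasoning

  -- Cyclic 0/1 sequences

  <ᵇ-true : ∀ {m n} → m < n → (m <ᵇ n) ≡ true
  <ᵇ-true lt = Equivalence.to T-≡ (<⇒<ᵇ lt)

  <ᵇ-false : ∀ {m n} → n ≤ m → (m <ᵇ n) ≡ false
  <ᵇ-false {m} {n} le = ¬-not λ eq → <⇒≱ (<ᵇ⇒< m n (Equivalence.from T-≡ eq)) le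

  𝟙≤1 : ∀ b → 𝟙 b ≤ 1
  𝟙≤1 true  = ≤-refl
  𝟙≤1 false = z≤n

  count-cong : ∀ n {f g : ℕ → Bool} → (∀ {s} → s < n → f s ≡ g s) → count n f ≡ count n g
  count-cong n eq = ∑-cong∈ (downFrom n) (λ s∈ → cong 𝟙 (eq (∈-downFrom⁻ s∈)))

  count-≥1 : ∀ n f {s} → s < n → f s ≡ true → 1 ≤ count n f
  count-≥1 (suc n) f {s} s<n eq with m≤n⇒m<n∨m≡n (s≤s⁻¹ s<n)
  ... | inj₁ lt   = ≤-trans (count-≥1 n f lt eq) (m≤n+m _ _)
  ... | inj₂ refl rewrite eq = s≤s z≤n

  count-≥2 : ∀ n f {s t} → s < t → t < n → f s ≡ true → f t ≡ true → 2 ≤ count n f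
  count-≥2 (suc n) f {s} {t} s<t t<n es et with m≤n⇒m<n∨m≡n (s≤s⁻¹ t<n)
  ... | inj₁ lt   = ≤-trans (count-≥2 n f s<t lt es et) (m≤n+m _ _)
  ... | inj₂ refl rewrite et = s≤s (count-≥1 n f s<t es)

  count-search : ∀ n f → 1 ≤ count n f → ∃[ s ] s < n × f s ≡ true
  count-search (suc n) f c with f n in eq
  ... | true  = n , ≤-refl , eq
  ... | false with count-search n f c
  ...   | s , lt , e = s , m<n⇒m<1+n lt , e

  count-search-false : ∀ n f → count n f < n → ∃[ s ] s < n × f s ≡ false
  count-search-false n f c with count-search n (not ∘ f) (+-cancelˡ-≤ (count n f) 1 _
    (≤-trans (≤-reflexive (+-comm _ 1)) (≤-trans c (≤-reflexive (sym (count-not n f))))))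
  ... | s , lt , e = s , lt , not-injective e

  count-initial : ∀ n l → l ≤ n → count n (_<ᵇ l) ≡ l
  count-initial zero    zero z≤n = refl
  count-initial (suc n) l le with m≤n⇒m<n∨m≡n le
  ... | inj₁ lt rewrite <ᵇ-false {n} {l} (s≤s⁻¹ lt) = count-initial n l (s≤s⁻¹ lt)
  ... | inj₂ refl rewrite <ᵇ-true {n} ≤-refl = cong suc
    (trans (count-cong n {g = _<ᵇ n} (λ {s} lt → trans (<ᵇ-true (m<n⇒m<1+n lt)) (sym (<ᵇ-true lt)))) (count-initial n n ≤-refl))

  -- A sequence that never falls is first false and then true, so the number of trues locates the
  -- switch.
  monotone-threshold : ∀ n k l f → k + l ≡ n → (∀ s → suc s < n → f s ≡ true → f (suc s) ≡ true) →
    count n f ≡ l → ∀ s → s < n → f s ≡ not (s <ᵇ k)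
  monotone-threshold (suc n) k l f kl mono cnt s lt = go (f n) l kl cnt refl
    where
    all-false : f n ≡ false → ∀ d t → t + d ≡ n → f t ≡ false
    all-false e zero    t eq = subst (λ z → f z ≡ false) (trans (sym eq) (+-identityʳ t)) e
    all-false e (suc d) t eq = ¬-not λ ft → contradiction
      (trans (sym (mono t (s≤s (≤-trans (s≤s (m≤m+n t d)) (≤-reflexive (trans (sym (+-suc t d)) eq)))) ft))
        (all-false e d (suc t) (trans (sym (+-suc t d)) eq))) λ ()
    go : ∀ v l → k + l ≡ suc n → count (suc n) f ≡ l → f n ≡ v → f s ≡ not (s <ᵇ k)
    go false l kl cnt e = trans (all-false e (n ∸ s) s (m+[n∸m]≡n (s≤s⁻¹ lt)))
      (cong not (sym (<ᵇ-true (≤-trans lt (≤-reflexive (trans (sym kl) (trans (cong (k +_) l≡0) (+-identityʳ k))))))))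
      where
      l≡0 : l ≡ 0
      l≡0 = trans (sym cnt) (trans (count-cong (suc n) {g = λ _ → false} (λ {t} t< → all-false e (n ∸ t) t (m+[n∸m]≡n (s≤s⁻¹ t<)))) (zeros (suc n)))
        where
        zeros : ∀ m → count m (λ _ → false) ≡ 0
        zeros zero    = refl
        zeros (suc m) = zeros m
    go true zero     kl  c e rewrite e = contradiction c λ ()
    go true (suc l′) kl′ c e rewrite e with m≤n⇒m<n∨m≡n (s≤s⁻¹ lt)
    ...   | inj₁ s<n = monotone-threshold n k l′ f (suc-injective (trans (sym (+-suc k l′)) kl′))
                         (λ t t< → mono t (m<n⇒m<1+n t<)) (suc-injective c) s s<n
    ...   | inj₂ refl = trans e (cong not (sym (<ᵇ-false (m+n≤o⇒m≤o k (≤-reflexive (suc-injective (trans (sym (+-suc k l′)) kl′)))))))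

  descent : (ℕ → Bool) → ℕ → Bool
  descent f s = f s ∧ not (f (suc s))

  ∑-shift : ∀ n (f : ℕ → ℕ) → (∀ s → f (s + n) ≡ f s) → ∀ t → ∑[ i ∈ downFrom n ] f (i + t) ≡ ∑ (downFrom n) f
  ∑-shift n f per zero    = ∑-cong (downFrom n) (λ i → cong f (+-identityʳ i))
  ∑-shift n f per (suc t) = trans
    (∑-cong (downFrom n) (λ i → cong f (+-suc i t)))
    (trans (+-cancelˡ-≡ (f t) _ _ (begin
       f t + ∑[ i ∈ downFrom n ] f (suc i + t) ≡⟨ sym (∑-downFrom-suc n (λ i → f (i + t))) ⟩
       f (n + t) + ∑[ i ∈ downFrom n ] f (i + t) ≡⟨ cong (_+ ∑[ i ∈ downFrom n ] f (i + t)) (trans (cong f (+-comm n t)) (per t)) ⟩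
       f t + ∑[ i ∈ downFrom n ] f (i + t) ∎))
     (∑-shift n f per t))
    where open ≡-Reasoning

  count-rotate : ∀ n (f : ℕ → Bool) → (∀ s → f (s + n) ≡ f s) → ∀ t → count n (λ i → f (i + t)) ≡ count n f
  count-rotate n f per = ∑-shift n (𝟙 ∘ f) (cong 𝟙 ∘ per)

  -- offset n s p is p − s modulo suc n; since n ≡ −1, the product avoids subtraction.
  offset : ℕ → ℕ → ℕ → ℕ
  offset n s p = (p + s * n) % suc n

  arc : ℕ → ℕ → ℕ → ℕ → Bool
  arc n l s p = offset n s p <ᵇ l

  offset-period : ∀ n s p → offset n (s + suc n) p ≡ offset n s p
  offset-period n s p = trans (cong (_% suc n) (lem n s p)) ([m+kn]%n≡m%n (p + s * n) n (suc n))
    where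
    lem : ∀ n s p → p + (s + suc n) * n ≡ p + s * n + n * suc n
    lem = solve-∀

  offset-suc : ∀ n s p → offset n (suc s) (suc p) ≡ offset n s p
  offset-suc n s p = trans (cong (_% suc n) (lem n s p)) ([m+kn]%n≡m%n (p + s * n) 1 (suc n))
    where
    lem : ∀ n s p → suc p + suc s * n ≡ p + s * n + 1 * suc n
    lem = solve-∀

  offset-periodʳ : ∀ n s p → offset n s (p + suc n) ≡ offset n s p
  offset-periodʳ n s p = trans (cong (_% suc n) (lem n s p)) ([m+kn]%n≡m%n (p + s * n) 1 (suc n))
    where
    lem : ∀ n s p → p + suc n + s * n ≡ p + s * n + 1 * suc n
    lem = solve-∀

  -- `u` and `v` witness the congruence of `p` and `s + d` modulo `suc n`, so that full turns are
  -- added on either side and never subtracted.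
  offset-unique : ∀ n s p d {u v} → d < suc n → p + u * suc n ≡ s + d + v * suc n → offset n s p ≡ d
  offset-unique n s p d {u} {v} d< eq = begin
    (p + s * n) % suc n                     ≡⟨ sym ([m+kn]%n≡m%n (p + s * n) u (suc n)) ⟩
    (p + s * n + u * suc n) % suc n         ≡⟨ cong (_% suc n) (trans (lem₁ p (s * n) (u * suc n)) (trans (cong (_+ s * n) eq) (lem₂ n s d v))) ⟩
    (d + (s + v) * suc n) % suc n           ≡⟨ [m+kn]%n≡m%n d (s + v) (suc n) ⟩
    d % suc n                               ≡⟨ m<n⇒m%n≡m d< ⟩
    d                                       ∎
    where
    open ≡-Reasoning
    lem₁ : ∀ a b c → a + b + c ≡ a + c + b
    lem₁ = solve-∀
    lem₂ : ∀ n s d v → s + d + v * suc n + s * n ≡ d + (s + v) * suc n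
    lem₂ = solve-∀

  count-arc : ∀ n l s → l ≤ suc n → count (suc n) (arc n l s) ≡ l
  count-arc n l zero    l≤ = trans (count-cong (suc n) {g = _<ᵇ l} (λ {p} p< → cong (_<ᵇ l)
    (trans (cong (_% suc n) (+-identityʳ p)) (m<n⇒m%n≡m p<)))) (count-initial (suc n) l l≤)
  count-arc n l (suc s) l≤ = trans (sym (count-rotate (suc n) (arc n l (suc s)) (λ p → cong (_<ᵇ l) (offset-periodʳ n (suc s) p)) 1))
    (trans (∑-cong (downFrom (suc n)) (λ p → cong (λ z → 𝟙 (z <ᵇ l)) (trans (cong (offset n (suc s)) (+-comm p 1)) (offset-suc n s p))))
      (count-arc n l s l≤))

  -- b s = false says that the arc of length l starting at s belongs to the (complemented) family.  Since r arcs of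
  -- length c cover the circle, every rotation of {0, c, 2c, …} meets the (suc m)-fold erosion of b, which therefore
  -- has at least n / r elements; each erosion removes at least one element, and the first removes one per descent.
  module Circle (n′ l r q m : ℕ) (b : ℕ → Bool)
    (period : ∀ s → b (s + suc n′) ≡ b s)
    (l≤n : l ≤ suc n′) (l≡ : suc q + suc m ≡ l) (rq<n : r * q < suc n′) (n≤rc : suc n′ ≤ r * suc q)
    (uncovered : ∀ (e : Fin r → ℕ) → (∀ j → b (e j) ≡ false) → ∃[ p ] ∀ j → arc n′ l (e j) p ≡ false)
    where

    n c : ℕ
    n = suc n′
    c = suc q

    -- False exactly when some arc of the family starts at one of `s`, ..., `s + j`.
    erode : ℕ → ℕ → Bool
    erode zero    s = b s
    erode (suc j) s = erode j s ∧ erode j (suc s)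

    erode-period : ∀ j s → erode j (s + n) ≡ erode j s
    erode-period zero    s = period s
    erode-period (suc j) s = cong₂ _∧_ (erode-period j s) (erode-period j (suc s))

    erode-false : ∀ j s → erode j s ≡ false → ∃[ d ] d ≤ j × b (s + d) ≡ false
    erode-false zero    s eq = 0 , z≤n , trans (cong b (+-identityʳ s)) eq
    erode-false (suc j) s eq with erode j s in eq₁
    ... | false with erode-false j s eq₁
    ...   | d , d≤ , e = d , m≤n⇒m≤1+n d≤ , e
    erode-false (suc j) s eq | true with erode-false j (suc s) eq
    ...   | d , d≤ , e = suc d , s≤s d≤ , trans (cong b (+-suc s d)) e

    false-erode : ∀ j s → b s ≡ false → erode j s ≡ false
    false-erode zero    s eq = eq
    false-erode (suc j) s eq rewrite false-erode j s eq = refl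

    -- Otherwise, for each `j`, an arc of the family starts at most `suc m` after `i + j * c`.
    -- Having length `c + suc m`, it contains the block of `c` points beginning at
    -- `i + j * c + suc m`. As `n ≤ r * c`, these `r` blocks cover the circle, against `uncovered`.
    some-eroded : ∀ i → ∃[ j ] erode (suc m) (i + toℕ {r} j * c) ≡ true
    some-eroded i with any? (λ j → erode (suc m) (i + toℕ {r} j * c) Bool.≟ true)
    ... | yes w = w
    ... | no ¬w = contradiction (proj₂ hole j₀) (λ eq → contradiction (trans (sym (<ᵇ-true (subst (_< l) (sym off) w<l))) eq) λ ())
      where
      ch : ∀ j → ∃[ d ] d ≤ suc m × b (i + toℕ {r} j * c + d) ≡ false
      ch j = erode-false (suc m) _ (¬-not λ eq → ¬w (j , eq))
      hole = uncovered (λ j → i + toℕ {r} j * c + proj₁ (ch j)) (λ j → proj₂ (proj₂ (ch j)))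
      p = proj₁ hole
      -- Distance of the uncovered point `p` from the beginning of block 0; `p` therefore lies in
      -- block `u / c`.
      u = offset n′ (i + suc m) p
      u<n : u < n
      u<n = m%n<n (p + (i + suc m) * n′) n
      j₀<r : u / c < r
      j₀<r = m<n*o⇒m/o<n (≤-trans u<n n≤rc)
      j₀ : Fin r
      j₀ = fromℕ< j₀<r
      u÷c = u / c
      d = proj₁ (ch j₀)
      d≤ = proj₁ (proj₂ (ch j₀))
      e w : ℕ
      e = suc m ∸ d
      w = u % c + e
      w<l : w < l
      w<l = ≤-trans (+-mono-≤ (m%n<n u c) (m∸n≤m (suc m) d)) (≤-reflexive l≡)
      V = (p + (i + suc m) * n′) / n
      open ≡-Reasoning
      eq₁ : p + (i + suc m) * n ≡ i + suc m + u + V * n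
      eq₁ = begin
        p + (i + suc m) * suc n′ ≡⟨ lem₁ p (i + suc m) n′ ⟩
        i + suc m + (p + (i + suc m) * n′) ≡⟨ cong (i + suc m +_) (m≡m%n+[m/n]*n (p + (i + suc m) * n′) n) ⟩
        i + suc m + (u + V * n) ≡⟨ sym (+-assoc (i + suc m) u _) ⟩
        i + suc m + u + V * n ∎
        where
        lem₁ : ∀ a b c → a + b * suc c ≡ b + (a + b * c)
        lem₁ = solve-∀
      eq₂ : i + suc m + u ≡ i + toℕ j₀ * c + d + w
      eq₂ = begin
        i + suc m + u ≡⟨ cong₂ (λ x y → i + x + y) (sym (m+[n∸m]≡n d≤)) (m≡m%n+[m/n]*n u c) ⟩
        i + (d + e) + (u % c + u÷c * c) ≡⟨ lem₂ i d e (u % c) (u÷c * c) ⟩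
        i + u÷c * c + d + w ≡⟨ cong (λ z → i + z * c + d + w) (sym (toℕ-fromℕ< j₀<r)) ⟩
        i + toℕ j₀ * c + d + w ∎
        where
        lem₂ : ∀ i d e a b → i + (d + e) + (a + b) ≡ i + b + d + (a + e)
        lem₂ = solve-∀
      off : offset n′ (i + toℕ j₀ * c + d) p ≡ w
      off = offset-unique n′ (i + toℕ j₀ * c + d) p w {i + suc m} {V} (≤-trans w<l l≤n) (trans eq₁ (cong (_+ V * n) eq₂))

    -- Sum `some-eroded` over all `i` and exchange the sums: each `j` contributes a rotated copy of
    -- the same count, so `n` is at most `r` times it, while `r * q < n`.
    eroded-count : c ≤ count n (erode (suc m))
    eroded-count = *-cancelˡ-< r q _ (≤-trans rq<n (begin
      n ≡⟨ sym (trans (∑-const (downFrom n) 1) (trans (*-identityʳ _) (length-downFrom n))) ⟩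
      ∑[ i ∈ downFrom n ] 1 ≤⟨ ∑-mono∈ (downFrom n) (λ {i} _ → one i) ⟩
      ∑[ i ∈ downFrom n ] ∑[ j ∈ downFrom r ] 𝟙 (erode (suc m) (i + j * c)) ≡⟨ ∑-swap (downFrom n) (downFrom r) _ ⟩
      ∑[ j ∈ downFrom r ] ∑[ i ∈ downFrom n ] 𝟙 (erode (suc m) (i + j * c)) ≡⟨ ∑-cong (downFrom r) (λ j → count-rotate n _ (erode-period (suc m)) (j * c)) ⟩
      ∑[ j ∈ downFrom r ] count n (erode (suc m)) ≡⟨ trans (∑-const (downFrom r) _) (cong (_* count n (erode (suc m))) (length-downFrom r)) ⟩
      r * count n (erode (suc m)) ∎))
      where
      open ≤-Reasoning
      one : ∀ i → 1 ≤ ∑[ j ∈ downFrom r ] 𝟙 (erode (suc m) (i + j * c))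
      one i with some-eroded i
      ... | j , eq = count-≥1 r (λ j → erode (suc m) (i + j * c)) (toℕ<n j) eq

    module _ (gap : ∃[ s ] b s ≡ false) where

      erode-split : ∀ j → count n (erode j) ≡ count n (erode (suc j)) + count n (descent (erode j))
      erode-split j = trans (∑-cong (downFrom n) (λ s → lem (erode j s) (erode j (suc s)))) (∑-+ (downFrom n) (𝟙 ∘ erode (suc j)) (𝟙 ∘ descent (erode j)))
        where
        lem : ∀ x y → 𝟙 x ≡ 𝟙 (x ∧ y) + 𝟙 (x ∧ not y)
        lem false _     = refl
        lem true  false = refl
        lem true  true  = refl

      -- Without a descent, truth passes from every point to the next and goes all round the circle,
      -- reaching the point where `f` is false.
      fall : (f : ℕ → Bool) (per : ∀ s → f (s + n) ≡ f s) → (∃[ s ] f s ≡ false) → 1 ≤ count n f →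
             1 ≤ count n (descent f)
      fall f per (t , ft) c≥1 with count n (descent f) in eq
      ... | suc _ = s≤s z≤n
      ... | zero  = contradiction (trans (sym (up t)) ft) λ ()
        where
        rot : ∀ u → count n (λ i → descent f (i + u)) ≡ 0
        rot u = trans (count-rotate n (descent f) (λ s → cong₂ (λ x y → x ∧ not y) (per s) (per (suc s))) u) eq
        step : ∀ u → f u ≡ true → f (suc u) ≡ true
        step u fu = not-injective (¬-not λ e → <⇒≱ (count-≥1 n (λ i → descent f (i + u)) {0} (s≤s z≤n) (cong₂ _∧_ fu e)) (≤-reflexive (rot u)))
        steps : ∀ u v → f u ≡ true → f (v + u) ≡ true
        steps u zero    fu = fu
        steps u (suc v) fu = step (v + u) (steps u v fu)
        per* : ∀ k s → f (s + k * n) ≡ f s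
        per* zero    s = cong f (+-identityʳ s)
        per* (suc k) s = trans (cong f (trans (cong (s +_) (+-comm n (k * n))) (sym (+-assoc s (k * n) n)))) (trans (per (s + k * n)) (per* k s))
        up : ∀ t → f t ≡ true
        up t with count-search n f c≥1
        -- From `s`, going forward `t + s * n′` steps ends at `t`, after `s` full turns.
        ... | s , s<n , fs = trans (sym (per* s t)) (trans (cong f (sym (reach t s))) (steps s (t + s * n′) fs))
          where
          reach : ∀ t s → t + s * n′ + s ≡ t + s * n
          reach = λ t s → lem t s n′
            where
            lem : ∀ t s n → t + s * n + s ≡ t + s * suc n
            lem = solve-∀

      gap-erode : ∀ j → ∃[ s ] erode j s ≡ false
      gap-erode j = proj₁ gap , false-erode j (proj₁ gap) (proj₂ gap)

      -- Going back from the last erosion, each step regains at least one point, by `fall`.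
      eroded-count-≥ : ∀ d j → j + d ≡ suc m → c + d ≤ count n (erode j)
      eroded-count-≥ zero    j eq rewrite +-identityʳ c | trans (sym (+-identityʳ j)) eq = eroded-count
      eroded-count-≥ (suc d) j eq = begin
        c + suc d ≡⟨ trans (cong (c +_) (+-comm 1 d)) (sym (+-assoc c d 1)) ⟩
        c + d + 1 ≤⟨ +-mono-≤ ih (fall (erode j) (erode-period j) (gap-erode j) ≥1) ⟩
        count n (erode (suc j)) + count n (descent (erode j)) ≡⟨ sym (erode-split j) ⟩
        count n (erode j) ∎
        where
        open ≤-Reasoning
        ih = eroded-count-≥ d (suc j) (trans (sym (+-suc j d)) eq)
        ≥1 : 1 ≤ count n (erode j)
        ≥1 = ≤-trans (s≤s z≤n) (≤-trans ih (≤-trans (m≤m+n _ _) (≤-reflexive (sym (erode-split j)))))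

      -- The first erosion costs one point per descent and still leaves at least `c + m`, which is
      -- `l − 1`. Both the bound and its equality case are read off from this.
      descent-bound : count n (descent b) + l ≤ suc (count n b)
      descent-bound = begin
        count n (descent b) + l ≡⟨ cong (count n (descent b) +_) (trans (sym l≡) (+-suc c m)) ⟩
        count n (descent b) + suc (c + m) ≡⟨ +-suc _ _ ⟩
        suc (count n (descent b) + (c + m)) ≤⟨ s≤s (+-monoʳ-≤ (count n (descent b)) (eroded-count-≥ m 1 refl)) ⟩
        suc (count n (descent b) + count n (erode 1)) ≡⟨ cong suc (trans (+-comm (count n (descent b)) _) (sym (erode-split 0))) ⟩
        suc (count n b) ∎
        where open ≤-Reasoning

      some-descent : 1 ≤ count n (descent b)
      some-descent = fall b period gap (≤-trans (s≤s z≤n) (eroded-count-≥ (suc m) 0 refl))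

    count-bound : l ≤ count n b
    count-bound with count n b <? n
    ... | no  ≥n = ≤-trans l≤n (≮⇒≥ ≥n)
    ... | yes <n with count-search-false n b <n
    ...   | s , _ , bs = +-cancelˡ-≤ 1 _ _ (≤-trans (+-monoˡ-≤ l (some-descent (s , bs))) (descent-bound (s , bs)))

    one-descent : (∃[ s ] b s ≡ false) → count n b ≤ l → count n (descent b) ≤ 1
    one-descent gap le = +-cancelʳ-≤ l _ _ (≤-trans (descent-bound gap) (s≤s le))

  -- Duplicate-free lists as finite sets

  _≟ˢ_ : ∀ {n} → DecidableEquality (Subset n)
  _≟ˢ_ = Vec.≡-dec Bool._≟_

  does-mono : ∀ {P Q : Set} (p? : Dec P) (q? : Dec Q) → (P → Q) → 𝟙 (does p?) ≤ 𝟙 (does q?)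
  does-mono (no _)  q? imp = z≤n
  does-mono (yes p) q? imp rewrite dec-true q? (imp p) = ≤-refl

  module _ {A : Set} (_≟_ : DecidableEquality A) where
    open import Data.List.Membership.DecPropositional _≟_ using (_∈?_)

    ∑-unique : ∀ {xs : List A} → Unique xs → ∀ y → ∑[ x ∈ xs ] 𝟙 (does (x ≟ y)) ≤ 𝟙 (does (y ∈? xs))
    ∑-unique {[]}     []       y = z≤n
    ∑-unique {x ∷ xs} (x∉ ∷ u) y with x ≟ y
    ... | yes refl rewrite dec-true (x ∈? (x ∷ xs)) (here refl) = s≤s (≤-reflexive (trans
            (∑-cong∈ xs (λ {z} z∈ → cong 𝟙 (dec-false (z ≟ y) λ { refl → All.lookup x∉ z∈ refl })))
            (trans (∑-const xs 0) (*-zeroʳ (length xs)))))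
    ... | no x≢y = ≤-trans (∑-unique u y) (does-mono (y ∈? xs) (y ∈? (x ∷ xs)) there)

    -- Count the pairs of equal entries twice: every `x` has a partner in `ys`, and a `y` has at
    -- most one in the duplicate-free `xs`.
    length≤∑∈ : ∀ {xs : List A} → Unique xs → ∀ ys → (∀ {x} → x ∈ xs → x ∈ ys) →
                length xs ≤ ∑[ y ∈ ys ] 𝟙 (does (y ∈? xs))
    length≤∑∈ {xs} u ys sub = begin
      length xs                                       ≡⟨ sym (trans (∑-const xs 1) (*-identityʳ _)) ⟩
      ∑[ x ∈ xs ] 1                                   ≤⟨ ∑-mono∈ xs (λ x∈ → hit ys (sub x∈)) ⟩
      ∑[ x ∈ xs ] ∑[ y ∈ ys ] 𝟙 (does (x ≟ y))        ≡⟨ ∑-swap xs ys _ ⟩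
      ∑[ y ∈ ys ] ∑[ x ∈ xs ] 𝟙 (does (x ≟ y))        ≤⟨ ∑-mono∈ ys (λ {y} _ → ∑-unique u y) ⟩
      ∑[ y ∈ ys ] 𝟙 (does (y ∈? xs))                  ∎
      where
      open ≤-Reasoning
      hit : ∀ {x} ys → x ∈ ys → 1 ≤ ∑[ y ∈ ys ] 𝟙 (does (x ≟ y))
      hit {x} (y ∷ ys) (here refl) rewrite dec-true (x ≟ x) refl = s≤s z≤n
      hit {x} (y ∷ ys) (there x∈) = ≤-trans (hit ys x∈) (m≤n+m _ _)

    length-mono-⊆ : ∀ {xs ys : List A} → Unique xs → (∀ {x} → x ∈ xs → x ∈ ys) → length xs ≤ length ys
    length-mono-⊆ {xs} {ys} u sub = ≤-trans (length≤∑∈ u ys sub)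
      (≤-trans (∑-mono∈ ys {g = λ _ → 1} (λ {y} _ → 𝟙≤1 (does (y ∈? xs)))) (≤-reflexive (trans (∑-const ys 1) (*-identityʳ _))))

  ∈-kSubsets : ∀ {n} (S : Subset n) → S ∈ kSubsets n ∣ S ∣
  ∈-kSubsets [] = here refl
  ∈-kSubsets {suc n} (true ∷ S)  = ∈-++⁺ˡ (∈-map⁺ (inside ∷_) (∈-kSubsets S))
  ∈-kSubsets {suc n} (false ∷ S) with ∣ S ∣ | ∈-kSubsets S
  ... | zero  | S∈ = ∈-map⁺ (outside ∷_) S∈
  ... | suc k | S∈ = ∈-++⁺ʳ (map (inside ∷_) (kSubsets n k)) (∈-map⁺ (outside ∷_) S∈)

  x∈⋂⁻ : ∀ {n} {x : Fin n} {S} L → x Subset.∈ ⋂ L → S ∈ L → x Subset.∈ S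
  x∈⋂⁻ (S ∷ L) x∈ (here refl) = proj₁ (x∈p∩q⁻ S (⋂ L) x∈)
  x∈⋂⁻ (S ∷ L) x∈ (there S∈)  = x∈⋂⁻ L (proj₂ (x∈p∩q⁻ S (⋂ L) x∈)) S∈

  x∈⋂⁺ : ∀ {n} {x : Fin n} L → (∀ {S} → S ∈ L → x Subset.∈ S) → x Subset.∈ ⋂ L
  x∈⋂⁺ []      all = ∈⊤
  x∈⋂⁺ (S ∷ L) all = x∈p∩q⁺ (all (here refl) , x∈⋂⁺ L (all ∘ there))

  -- Elements at prescribed positions

  insertIf-cong : ∀ {N a b} {x : Fin N} {S T} → a ≡ b → S ≡ T → insertIf a x S ≡ insertIf b x T
  insertIf-cong refl refl = refl

  insertIf-comm : ∀ {N} a b (x y : Fin N) S → insertIf a x (insertIf b y S) ≡ insertIf b y (insertIf a x S)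
  insertIf-comm true  true  x y S = ∪-swap ⁅ x ⁆ ⁅ y ⁆ S
  insertIf-comm true  false x y S = refl
  insertIf-comm false true  x y S = refl
  insertIf-comm false false x y S = refl

  elementsAt-cong : ∀ {N} (xs : List (Fin N)) {P Q} → (∀ p → p < length xs → P p ≡ Q p) → elementsAt P xs ≡ elementsAt Q xs
  elementsAt-cong []       eq = refl
  elementsAt-cong (x ∷ xs) eq = insertIf-cong (eq 0 (s≤s z≤n)) (elementsAt-cong xs (λ p p< → eq (suc p) (s≤s p<)))

  elementsAt-∷ʳ : ∀ {N} P (xs : List (Fin N)) y → elementsAt P (xs ∷ʳ y) ≡ insertIf (P (length xs)) y (elementsAt P xs)
  elementsAt-∷ʳ P []       y = refl
  elementsAt-∷ʳ P (x ∷ xs) y = trans (cong (insertIf (P 0) x) (elementsAt-∷ʳ (P ∘ suc) xs y))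
    (insertIf-comm (P 0) (P (suc (length xs))) x y (elementsAt (P ∘ suc) xs))

  elementsAt-swap : ∀ {N} P us (x y : Fin N) vs → P (length us) ≡ P (suc (length us)) →
                    elementsAt P (us ++ x ∷ y ∷ vs) ≡ elementsAt P (us ++ y ∷ x ∷ vs)
  elementsAt-swap P []       x y vs eq = trans (insertIf-comm (P 0) (P 1) x y _)
    (trans (insertIf-cong (sym eq) (insertIf-cong eq refl)) refl)
  elementsAt-swap P (u ∷ us) x y vs eq = cong (insertIf (P 0) u) (elementsAt-swap (P ∘ suc) us x y vs eq)

  x∈insertIf⁻ : ∀ {N} b {x z : Fin N} S → z Subset.∈ insertIf b x S → (b ≡ true × z ≡ x) ⊎ z Subset.∈ S
  x∈insertIf⁻ false S z∈ = inj₂ z∈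
  x∈insertIf⁻ true {x} S z∈ with x∈p∪q⁻ ⁅ x ⁆ S z∈
  ... | inj₁ z∈x = inj₁ (refl , x∈⁅y⁆⇒x≡y x z∈x)
  ... | inj₂ z∈S = inj₂ z∈S

  elementsAt⊆ : ∀ {N} P (xs : List (Fin N)) {z} → z Subset.∈ elementsAt P xs → z ∈ xs
  elementsAt⊆ P []       z∈ = contradiction z∈ ∉⊥
  elementsAt⊆ P (x ∷ xs) z∈ with x∈insertIf⁻ (P 0) _ z∈
  ... | inj₁ (_ , refl) = here refl
  ... | inj₂ z∈′        = there (elementsAt⊆ (P ∘ suc) xs z∈′)

  -- The entries are distinct, so `z` sits at one place only. The place is chosen before `P`, so
  -- that the same one serves all `r` arcs at once.
  position : ∀ {N} {xs : List (Fin N)} {z} → Unique xs → z ∈ xs →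
             ∃[ p ] ∀ P → z Subset.∈ elementsAt P xs → P p ≡ true
  position {xs = x ∷ xs} (x∉ ∷ u) (here refl) = 0 , at
    where
    at : ∀ P → x Subset.∈ elementsAt P (x ∷ xs) → P 0 ≡ true
    at P z∈ with x∈insertIf⁻ (P 0) _ z∈
    ... | inj₁ (eq , _) = eq
    ... | inj₂ z∈′      = contradiction refl (All.lookup x∉ (elementsAt⊆ (P ∘ suc) xs z∈′))
  position {xs = x ∷ xs} {z} (x∉ ∷ u) (there z∈xs) with position u z∈xs
  ... | p , at′ = suc p , at
    where
    at : ∀ P → z Subset.∈ elementsAt P (x ∷ xs) → P (suc p) ≡ true
    at P z∈ with x∈insertIf⁻ (P 0) _ z∈
    ... | inj₁ (_ , refl) = contradiction refl (All.lookup x∉ z∈xs)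
    ... | inj₂ z∈′        = at′ (P ∘ suc) z∈′

  Unique-resp-↭ : ∀ {A : Set} {xs ys : List A} → xs ↭ ys → Unique xs → Unique ys
  Unique-resp-↭ {A} p = Permutationₛ.Unique-resp-↭ (setoid A) (↭⇒↭ₛ p)

  elements : ∀ {n} → Subset n → List (Fin n)
  elements []            = []
  elements (true  ∷ S) = zero ∷ map suc (elements S)
  elements (false ∷ S) = map suc (elements S)

  length-elements : ∀ {n} (S : Subset n) → length (elements S) ≡ ∣ S ∣
  length-elements []            = refl
  length-elements (true  ∷ S) = cong suc (trans (length-map suc (elements S)) (length-elements S))
  length-elements (false ∷ S) = trans (length-map suc (elements S)) (length-elements S)

  ∈-elements : ∀ {n x} (S : Subset n) → x Subset.∈ S → x ∈ elements S
  ∈-elements (true  ∷ S) Vec.here       = here refl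
  ∈-elements (true  ∷ S) (Vec.there x∈) = there (∈-map⁺ suc (∈-elements S x∈))
  ∈-elements (false ∷ S) (Vec.there x∈) = ∈-map⁺ suc (∈-elements S x∈)

  elements-partition : ∀ {n} (S : Subset n) → elements S ++ elements (∁ S) ↭ allFin n
  elements-partition [] = ↭-refl
  elements-partition {suc n} (b ∷ S) rewrite sym (map-tabulate {n = n} id Fin.suc) = go b
    where
    tail : map Fin.suc (elements S) ++ map suc (elements (∁ S)) ↭ map suc (allFin n)
    tail = ↭-trans (↭-reflexive (sym (map-++ suc (elements S) _))) (map⁺ suc (elements-partition S))
    go : ∀ b → elements (b ∷ S) ++ elements (not b ∷ ∁ S) ↭ zero ∷ map suc (allFin n)
    go true  = prep zero tail
    go false = ↭-trans (shift zero (map suc (elements S)) _) (prep zero tail)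

  elementsAt-map-suc : ∀ {n} P (xs : List (Fin n)) → elementsAt P (map suc xs) ≡ outside ∷ elementsAt P xs
  elementsAt-map-suc P []       = refl
  elementsAt-map-suc P (x ∷ xs) = trans (cong (insertIf (P 0) (suc x)) (elementsAt-map-suc (P ∘ suc) xs)) (lem (P 0))
    where
    lem : ∀ b → insertIf b (suc x) (outside ∷ elementsAt (P ∘ suc) xs) ≡ outside ∷ insertIf b x (elementsAt (P ∘ suc) xs)
    lem true  = refl
    lem false = refl

  elementsAt-prefix : ∀ {n} (xs ys : List (Fin n)) → elementsAt (_<ᵇ length xs) (xs ++ ys) ≡ elementsAt (λ _ → true) xs
  elementsAt-prefix []       ys = go ys
    where
    go : ∀ ys → elementsAt (_<ᵇ 0) ys ≡ ⊥
    go []       = refl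
    go (y ∷ ys) = go ys
  elementsAt-prefix (x ∷ xs) ys = cong (⁅ x ⁆ ∪_) (elementsAt-prefix xs ys)

  elementsAt-elements : ∀ {n} (S : Subset n) → elementsAt (λ _ → true) (elements S) ≡ S
  elementsAt-elements [] = refl
  elementsAt-elements (true  ∷ S) = trans (cong (⁅ zero ⁆ ∪_) (elementsAt-map-suc _ (elements S)))
    (cong (inside ∷_) (trans (∪-identityˡ _) (elementsAt-elements S)))
  elementsAt-elements (false ∷ S) = trans (elementsAt-map-suc _ (elements S)) (cong (outside ∷_) (elementsAt-elements S))

  -- List `F` first, then its complement with `x` moved to the end.
  arrange-with-last : ∀ {n} (F : Subset n) x → x Subset.∉ F →
    ∃[ ys ] ys ∷ʳ x ↭ allFin n × elementsAt (_<ᵇ ∣ F ∣) (ys ∷ʳ x) ≡ F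
  arrange-with-last F x x∉F with ∈-∃++ (∈-elements (∁ F) (x∉p⇒x∈∁p x∉F))
  ... | us , vs , eq = elements F ++ us ++ vs
    , ↭-trans (↭-trans (↭-sym (∷↭∷ʳ x _)) (↭-sym split)) (elements-partition F)
    , trans (cong (λ z → elementsAt (_<ᵇ ∣ F ∣) z) (++-assoc (elements F) (us ++ vs) [ x ]))
      (trans (cong (λ z → elementsAt (_<ᵇ z) (elements F ++ ((us ++ vs) ∷ʳ x))) (sym (length-elements F)))
        (trans (elementsAt-prefix (elements F) _) (elementsAt-elements F)))
    where
    split : elements F ++ elements (∁ F) ↭ x ∷ elements F ++ us ++ vs
    split = ↭-trans (↭-reflexive (cong (elements F ++_) eq))
      (↭-trans (++⁺ˡ (elements F) (shift x us vs)) (shift x (elements F) (us ++ vs)))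

  -- Changing a 0/1 sequence at two places

  count-agree : ∀ n f g {i} → i < n → (∀ s → s < n → s ≢ i → f s ≡ g s) → count n f + 𝟙 (g i) ≡ count n g + 𝟙 (f i)
  count-agree (suc n) f g {i} i<n eq with m≤n⇒m<n∨m≡n (s≤s⁻¹ i<n)
  ... | inj₂ refl = trans (cong (λ z → 𝟙 (f n) + z + 𝟙 (g n)) (count-cong n {f} {g} (λ {s} s< → eq s (m<n⇒m<1+n s<) (<⇒≢ s<))))
    (lem (𝟙 (f n)) (count n g) (𝟙 (g n)))
    where
    lem : ∀ a b c → a + b + c ≡ c + b + a
    lem = solve-∀
  ... | inj₁ lt = begin
    𝟙 (f n) + count n f + 𝟙 (g i)   ≡⟨ +-assoc (𝟙 (f n)) _ _ ⟩
    𝟙 (f n) + (count n f + 𝟙 (g i)) ≡⟨ cong₂ _+_ (cong 𝟙 (eq n ≤-refl (≢-sym (<⇒≢ lt)))) (count-agree n f g lt (λ s s< → eq s (m<n⇒m<1+n s<))) ⟩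
    𝟙 (g n) + (count n g + 𝟙 (f i)) ≡⟨ sym (+-assoc (𝟙 (g n)) _ _) ⟩
    𝟙 (g n) + count n g + 𝟙 (f i)   ∎
    where open ≡-Reasoning

  count-agree₂ : ∀ n f g {i j} → i < n → j < n → i ≢ j → (∀ s → s < n → s ≢ i → s ≢ j → f s ≡ g s) →
                 count n f ≡ count n g → 𝟙 (f i) + 𝟙 (f j) ≡ 𝟙 (g i) + 𝟙 (g j)
  count-agree₂ n f g {i} {j} i<n j<n i≢j eq cnt = +-cancelˡ-≡ (count n g + count n h) _ _ (begin
    count n g + count n h + (𝟙 (f i) + 𝟙 (f j))        ≡⟨ lem (count n g) (count n h) (𝟙 (f i)) (𝟙 (f j)) ⟩
    (count n h + 𝟙 (f i)) + (count n g + 𝟙 (f j))      ≡⟨ cong₂ _+_ (sym e₁) (sym e₂) ⟩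
    (count n f + 𝟙 (g i)) + (count n h + 𝟙 (g j))      ≡⟨ cong (λ z → z + 𝟙 (g i) + (count n h + 𝟙 (g j))) cnt ⟩
    (count n g + 𝟙 (g i)) + (count n h + 𝟙 (g j))      ≡⟨ lem′ (count n g) (count n h) (𝟙 (g i)) (𝟙 (g j)) ⟩
    count n g + count n h + (𝟙 (g i) + 𝟙 (g j))        ∎)
    where
    open ≡-Reasoning
    -- A hybrid of `f` and `g`, so that each of the two comparisons changes a single place.
    h : ℕ → Bool
    h s = if does (s ≟ i) then g i else f s
    hi : h i ≡ g i
    hi rewrite dec-true (i ≟ i) refl = refl
    h≢ : ∀ s → s ≢ i → h s ≡ f s
    h≢ s s≢i rewrite dec-false (s ≟ i) s≢i = refl
    e₁ : count n f + 𝟙 (g i) ≡ count n h + 𝟙 (f i)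
    e₁ = trans (cong (λ z → count n f + 𝟙 z) (sym hi)) (count-agree n f h i<n (λ s _ s≢i → sym (h≢ s s≢i)))
    e₂ : count n h + 𝟙 (g j) ≡ count n g + 𝟙 (f j)
    e₂ = trans (count-agree n h g j<n agree) (cong (λ z → count n g + 𝟙 z) (h≢ j (≢-sym i≢j)))
      where
      agree : ∀ s → s < n → s ≢ j → h s ≡ g s
      agree s s<n s≢j with s ≟ i
      ... | yes refl = hi
      ... | no s≢i   = trans (h≢ s s≢i) (eq s s<n s≢i s≢j)
    lem : ∀ a b c d → a + b + (c + d) ≡ b + c + (a + d)
    lem = solve-∀
    lem′ : ∀ a b c d → a + c + (b + d) ≡ a + b + (c + d)
    lem′ = solve-∀

  Threshold : ℕ → ℕ → (ℕ → Bool) → Set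
  Threshold n k f = ∀ s → s < n → f s ≡ not (s <ᵇ k)

  module _ (n′ k l : ℕ) (k+l≡n : k + l ≡ suc n′) (l<k : l < k) (f g : ℕ → Bool) (thr : Threshold (suc n′) k f)
    (period : g (suc n′) ≡ g 0) (count≡ : count (suc n′) f ≡ count (suc n′) g) (one : count (suc n′) (descent g) ≤ 1) where

    private
      below : ∀ {s} → s < k → f s ≡ false
      below s<k = trans (thr _ (≤-trans s<k (≤-trans (m≤m+n k l) (≤-reflexive k+l≡n)))) (cong not (<ᵇ-true s<k))

      above : ∀ {s} → s < suc n′ → k ≤ s → f s ≡ true
      above s<n k≤s = trans (thr _ s<n) (cong not (<ᵇ-false k≤s))

      no-two : ∀ {s t} → s < t → t < suc n′ → g s ≡ true → g (suc s) ≡ false → g t ≡ true → g (suc t) ≡ false → ∀ {A : Set} → A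
      no-two s<t t<n gs gs′ gt gt′ = contradiction one (<⇒≱ (count-≥2 (suc n′) (descent g) s<t t<n
        (cong₂ (λ x y → x ∧ not y) gs gs′) (cong₂ (λ x y → x ∧ not y) gt gt′)))

      agree : ∀ {i j} → f i ≡ g i → f j ≡ g j → (∀ s → s < suc n′ → s ≢ i → s ≢ j → f s ≡ g s) → Threshold (suc n′) k g
      agree {i} {j} ei ej eq s s<n with s ≟ i | s ≟ j
      ... | yes refl | _        = trans (sym ei) (thr s s<n)
      ... | no _     | yes refl = trans (sym ej) (thr s s<n)
      ... | no s≢i   | no s≢j   = trans (sym (eq s s<n s≢i s≢j)) (thr s s<n)

    -- `i` and `j` stand for the starts of the two arcs that an exchange of neighbours affects.
    -- Equal counts leave only a trade of values, with `f i` true. Then `g` falls after `j`, inside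
    -- the false range, and again at the end of the period: two descents. Here `l < k ≤ i` keeps `j`
    -- away from 0.
    threshold-stable₁ : ∀ {i j} → j + l ≡ i → i < n′ → i ≢ j → (∀ s → s < suc n′ → s ≢ i → s ≢ j → f s ≡ g s) → Threshold (suc n′) k g
    threshold-stable₁ {i} {j} refl i<n′ i≢j eq = go (f i) (g i) (g j) refl refl refl
      where
      j<n : j < suc n′
      j<n = ≤-trans (s≤s (m≤m+n j l)) (m<n⇒m<1+n i<n′)
      j+1<k : suc j < k
      j+1<k = +-cancelʳ-≤ l _ _ (≤-trans (s≤s i<n′) (≤-reflexive (sym k+l≡n)))
      fj : f j ≡ false
      fj = below (<-trans (n<1+n j) j+1<k)
      sums = count-agree₂ (suc n′) f g (m<n⇒m<1+n i<n′) j<n i≢j eq count≡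
      go : ∀ fi gi gj → f i ≡ fi → g i ≡ gi → g j ≡ gj → Threshold (suc n′) k g
      go fi gi gj efi egi egj with subst₂ (λ x y → x ≡ y) (cong₂ (λ a b → 𝟙 a + 𝟙 b) efi fj) (cong₂ (λ a b → 𝟙 a + 𝟙 b) egi egj) sums
      go false false false efi egi egj | _ = agree (trans efi (sym egi)) (trans fj (sym egj)) eq
      go true  true  false efi egi egj | _ = agree (trans efi (sym egi)) (trans fj (sym egj)) eq
      go true  false true  efi egi egj | _ = no-two j<n′ ≤-refl egj
          (trans (sym (eq (suc j) (≤-trans j+1<k k≤n) j+1≢i (λ ()))) (below j+1<k))
          (trans (sym (eq n′ ≤-refl (≢-sym (<⇒≢ i<n′)) (≢-sym (<⇒≢ j<n′)))) (above ≤-refl (s≤s⁻¹ (≤-trans k<n ≤-refl))))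
          (trans period (trans (sym (eq 0 (s≤s z≤n) (<⇒≢ (≤-trans (s≤s z≤n) k≤i)) (<⇒≢ 0<j))) (below (≤-trans (s≤s z≤n) l<k))))
        where
        k≤i : suc l ≤ i
        k≤i = ≤-trans l<k (≮⇒≥ λ i<k → contradiction (trans (sym efi) (below i<k)) λ ())
        0<j : 0 < j
        0<j = +-cancelʳ-≤ l 1 j k≤i
        j<n′ : j < n′
        j<n′ = ≤-trans (s≤s (m≤m+n j l)) i<n′
        k≤n = ≤-trans (m≤m+n k l) (≤-reflexive k+l≡n)
        j+1≢i : suc j ≢ i
        j+1≢i e = contradiction (trans (sym efi) (trans (cong f (sym e)) (below j+1<k))) λ ()
        k<n : k < suc n′
        k<n = ≤-trans (s≤s (≮⇒≥ {i} {k} λ i<k → contradiction (trans (sym efi) (below i<k)) λ ())) (m<n⇒m<1+n i<n′)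

    -- The case where the second arc wraps round. A trade of values makes `g` fall after `i` and
    -- again on arriving at `j`; `0 < i` keeps the predecessor of `j` in the true range.
    threshold-stable₂ : ∀ {i j} → 0 < i → i < l → j ≡ i + k → (∀ s → s < suc n′ → s ≢ i → s ≢ j → f s ≡ g s) → Threshold (suc n′) k g
    threshold-stable₂ {suc i} {j} _ i<l refl eq = go (g (suc i)) (g j) refl refl
      where
      j<n : j < suc n′
      j<n = ≤-trans (+-monoˡ-< k i<l) (≤-reflexive (trans (+-comm l k) k+l≡n))
      i<k = <-trans i<l l<k
      fi : f (suc i) ≡ false
      fi = below i<k
      fj : f j ≡ true
      fj = above j<n (m≤n+m k (suc i))
      i<j : suc i < j
      i<j = ≤-trans i<k (m≤n+m k (suc i))
      sums = count-agree₂ (suc n′) f g (≤-trans i<j (<⇒≤ j<n)) j<n (<⇒≢ i<j) eq count≡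
      go : ∀ gi gj → g (suc i) ≡ gi → g j ≡ gj → Threshold (suc n′) k g
      go gi gj egi egj with subst₂ (λ x y → x ≡ y) (cong₂ (λ a b → 𝟙 a + 𝟙 b) fi fj) (cong₂ (λ a b → 𝟙 a + 𝟙 b) egi egj) sums
      go false true  egi egj | _ = agree (trans fi (sym egi)) (trans fj (sym egj)) eq
      go true  false egi egj | _ = no-two (≤-trans i<k (m≤n+m k i)) (<-trans (n<1+n (i + k)) j<n) egi
        (trans (sym (eq (suc (suc i)) (≤-trans i+1<k (≤-trans (m≤m+n k l) (≤-reflexive k+l≡n))) (λ ()) (<⇒≢ (≤-trans i+1<k (m≤n+m k (suc i)))))) (below i+1<k))
        (trans (sym (eq (i + k) (<-trans (n<1+n (i + k)) j<n) (≢-sym (<⇒≢ (≤-trans i<k (m≤n+m k i)))) (<⇒≢ (n<1+n (i + k))))) (above (<-trans (n<1+n (i + k)) j<n) (m≤n+m k i)))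
        egj
        where
        i+1<k : suc (suc i) < k
        i+1<k = ≤-trans (s≤s i<l) l<k

  -- The upper bound

  absorption : ∀ n k → suc k * (suc n C suc k) ≡ suc n * (n C k)
  absorption zero    zero    = refl
  absorption zero    (suc k) = trans (cong (suc (suc k) *_) (k>n⇒nCk≡0 {1} {suc (suc k)} (s≤s (s≤s z≤n))))
    (trans (*-zeroʳ (suc (suc k))) (sym (cong (1 *_) (k>n⇒nCk≡0 {0} {suc k} (s≤s z≤n)))))
  absorption (suc n) zero    = trans (*-identityˡ (suc (suc n) C 1)) (trans (nC1≡n (suc (suc n))) (sym (*-identityʳ (suc (suc n)))))
  absorption (suc n) (suc k) = begin
    suc (suc k) * (suc (suc n) C suc (suc k)) ≡⟨ cong (suc (suc k) *_) (sym (nCk+nC[k+1]≡[n+1]C[k+1] (suc n) (suc k))) ⟩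
    suc (suc k) * (X + (suc n C suc (suc k))) ≡⟨ lem k X (suc n C suc (suc k)) ⟩
    X + (suc k * X + suc (suc k) * (suc n C suc (suc k))) ≡⟨ cong₂ (λ a b → X + (a + b)) (absorption n k) (absorption n (suc k)) ⟩
    X + (suc n * (n C k) + suc n * (n C suc k)) ≡⟨ cong (X +_) (sym (*-distribˡ-+ (suc n) (n C k) _)) ⟩
    X + suc n * (n C k + n C suc k) ≡⟨ cong (λ z → X + suc n * z) (nCk+nC[k+1]≡[n+1]C[k+1] n k) ⟩
    suc (suc n) * X ∎
    where
    open ≡-Reasoning
    X = suc n C suc k
    lem : ∀ k x y → suc (suc k) * (x + y) ≡ x + (suc k * x + suc (suc k) * y)
    lem = solve-∀

  length-kSubsets : ∀ n k → length (kSubsets n k) ≡ n C k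
  length-kSubsets zero    zero    = refl
  length-kSubsets zero    (suc k) = refl
  length-kSubsets (suc n) zero    = trans (length-map _ (kSubsets n 0)) (length-kSubsets n 0)
  length-kSubsets (suc n) (suc k) = trans (length-++ (map (inside ∷_) (kSubsets n k)))
    (trans (cong₂ _+_ (trans (length-map _ (kSubsets n k)) (length-kSubsets n k)) (trans (length-map _ (kSubsets n (suc k))) (length-kSubsets n (suc k))))
      (nCk+nC[k+1]≡[n+1]C[k+1] n k))

  module Katona (n′ k₁ l r q m : ℕ) (k+l≡n : suc k₁ + l ≡ suc n′) (l<k : l < suc k₁) (l≡ : suc q + suc m ≡ l)
    (rq<n : r * q < suc n′) (n≤rc : suc n′ ≤ r * suc q)
    (𝓕 : Family (suc n′) (suc k₁)) (intersecting : Intersecting r 𝓕) (nonTrivial : NonTrivial 𝓕) where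

    private
      n k : ℕ
      n = suc n′
      k = suc k₁
      module ∈? = DecMembership (_≟ˢ_ {n})

      l≤n : l ≤ n
      l≤n = ≤-trans (m≤n+m l k) (≤-reflexive k+l≡n)

      0<l : 0 < l
      0<l = ≤-trans (s≤s z≤n) (≤-reflexive l≡)

      k<n : k < n
      k<n = ≤-trans (≤-trans (≤-reflexive (+-comm 1 k)) (+-monoʳ-≤ k 0<l)) (≤-reflexive k+l≡n)

      length-allFin : length (allFin n) ≡ n
      length-allFin = length-tabulate id

    inFamily : Subset n → Bool
    inFamily S = does (S ∈?.∈? members 𝓕)

    -- coarc s is the cyclic interval of k positions ending just before s, the complement of arc s.
    coarc : ℕ → ℕ → Bool
    coarc s p = not (arc n′ l s p)

    hit miss : List (Fin n) → ℕ → Bool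
    hit  π s = inFamily (elementsAt (coarc s) π)
    miss π s = not (hit π s)

    count-coarc : ∀ s → count n (coarc s) ≡ k
    count-coarc s = +-cancelˡ-≡ l _ _ (trans (cong (_+ count n (coarc s)) (sym (count-arc n′ l s l≤n)))
      (trans (count-not n (arc n′ l s)) (trans (sym k+l≡n) (+-comm k l))))

    coarc-cong : ∀ {s t} π → (∀ p → arc n′ l s p ≡ arc n′ l t p) → miss π s ≡ miss π t
    coarc-cong π eq = cong (not ∘ inFamily) (elementsAt-cong π (λ p _ → cong not (eq p)))

    hit-member : ∀ π s → miss π s ≡ false → elementsAt (coarc s) π ∈ members 𝓕
    hit-member π s eq with elementsAt (coarc s) π ∈?.∈? members 𝓕
    ... | yes S∈ = S∈

    module _ {π : List (Fin n)} (π↭ : π ↭ allFin n) where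

      miss-period : ∀ s → miss π (s + n) ≡ miss π s
      miss-period s = coarc-cong {s + n} {s} π (λ p → cong (_<ᵇ l) (offset-period n′ s p))

      -- An element common to `r` members sits at a position in all their coarcs, hence outside all
      -- the arcs.
      uncovered : ∀ (e : Fin r → ℕ) → (∀ j → miss π (e j) ≡ false) → ∃[ p ] ∀ j → arc n′ l (e j) p ≡ false
      uncovered e hits with intersecting (λ j → elementsAt (coarc (e j)) π) (λ j → hit-member π (e j) (hits j))
      ... | z , z∈ with position (Unique-resp-↭ (↭-sym π↭) (Unique.allFin⁺ n)) (∈-resp-↭ (↭-sym π↭) (∈-allFin z))
      ...   | p , at = p , λ j → trans (sym (not-involutive _)) (cong not (at (coarc (e j)) (x∈⋂⁻ _ z∈ (∈-tabulate⁺ j))))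

      module Circ = Circle n′ l r q m (miss π) miss-period l≤n l≡ rq<n n≤rc uncovered

      hit-bound : count n (hit π) ≤ k
      hit-bound = +-cancelʳ-≤ l _ _ (≤-trans (+-monoʳ-≤ (count n (hit π)) Circ.count-bound)
        (≤-reflexive (trans (count-not n (hit π)) (sym k+l≡n))))

    ∑-hit : ∑[ π ∈ arrangements n (allFin n) ] count n (hit π) ≡ n * (k ! * l ! * ∑[ S ∈ kSubsets n k ] 𝟙 (inFamily S))
    ∑-hit = begin
      ∑[ π ∈ arrangements n (allFin n) ] ∑[ s ∈ downFrom n ] 𝟙 (hit π s)
        ≡⟨ ∑-swap (arrangements n (allFin n)) (downFrom n) _ ⟩
      ∑[ s ∈ downFrom n ] ∑[ π ∈ arrangements n (allFin n) ] 𝟙 (hit π s)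
        ≡⟨ ∑-cong (downFrom n) (λ s → trans
             (∑-arrangements n (allFin n) (coarc s) k l (𝟙 ∘ inFamily) length-allFin (count-coarc s)
               (trans (∑-cong (downFrom n) (λ p → cong 𝟙 (not-involutive _))) (count-arc n′ l s l≤n)))
             (cong (k ! * l ! *_) (∑Sub-allFin n k _))) ⟩
      ∑[ s ∈ downFrom n ] (k ! * l ! * ∑[ S ∈ kSubsets n k ] 𝟙 (inFamily S))
        ≡⟨ trans (∑-const (downFrom n) c) (cong (_* c) (length-downFrom n)) ⟩
      n * (k ! * l ! * ∑[ S ∈ kSubsets n k ] 𝟙 (inFamily S)) ∎
      where
      open ≡-Reasoning
      c = k ! * l ! * ∑[ S ∈ kSubsets n k ] 𝟙 (inFamily S)

    -- The number of arrangements is itself an instance of `∑-arrangements`, with constant summand.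
    -- Absorption brings it to the shape of `∑-hit`, so that comparing the sums compares the family
    -- with `n′ C k₁`.
    ∑-k : ∑[ π ∈ arrangements n (allFin n) ] k ≡ n * (k ! * l ! * (n′ C k₁))
    ∑-k = begin
      ∑[ π ∈ arrangements n (allFin n) ] k ≡⟨ ∑-const (arrangements n (allFin n)) k ⟩
      length (arrangements n (allFin n)) * k ≡⟨ cong (_* k) (trans (sym (*-identityʳ (length (arrangements n (allFin n))))) (sym (∑-const (arrangements n (allFin n)) 1))) ⟩
      (∑[ π ∈ arrangements n (allFin n) ] 1) * k
        ≡⟨ cong (_* k) (∑-arrangements n (allFin n) (coarc 0) k l (λ _ → 1) length-allFin (count-coarc 0)
               (trans (∑-cong (downFrom n) (λ p → cong 𝟙 (not-involutive _))) (count-arc n′ l 0 l≤n))) ⟩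
      k ! * l ! * ∑Sub (allFin n) k (λ _ → 1) * k
        ≡⟨ cong (λ z → k ! * l ! * z * k) (trans (∑Sub-allFin n k _) (trans (∑-const (kSubsets n k) 1) (trans (*-identityʳ (length (kSubsets n k))) (length-kSubsets n k)))) ⟩
      k ! * l ! * (n C k) * k ≡⟨ trans (*-assoc (k ! * l !) (n C k) k) (cong (k ! * l ! *_) (trans (*-comm (n C k) k) (absorption n′ k₁))) ⟩
      k ! * l ! * (n * (n′ C k₁)) ≡⟨ lem (k ! * l !) n (n′ C k₁) ⟩
      n * (k ! * l ! * (n′ C k₁)) ∎
      where
      open ≡-Reasoning
      lem : ∀ a b c → a * (b * c) ≡ b * (a * c)
      lem = solve-∀

    module _ (large : n′ C k₁ ≤ size 𝓕) where

      size≤ : size 𝓕 ≤ ∑[ S ∈ kSubsets n k ] 𝟙 (inFamily S)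
      size≤ = length≤∑∈ _≟ˢ_ (unique 𝓕) (kSubsets n k)
        λ {S} S∈ → subst (λ j → S ∈ kSubsets n j) (All.lookup (uniform 𝓕) S∈) (∈-kSubsets S)

      ∑-k≤∑-hit : ∑[ π ∈ arrangements n (allFin n) ] k ≤ ∑[ π ∈ arrangements n (allFin n) ] count n (hit π)
      ∑-k≤∑-hit = subst₂ _≤_ (sym ∑-k) (sym ∑-hit) (scale n (k ! * l !) (≤-trans large size≤))
        where
        scale : ∀ a b {c d} → c ≤ d → a * (b * c) ≤ a * (b * d)
        scale a b le = *-monoʳ-≤ a (*-monoʳ-≤ b le)

      saturated : ∀ {π} → π ↭ allFin n → k ≤ count n (hit π)
      saturated {π} π↭ = ∑-tight (arrangements n (allFin n)) {λ π → count n (hit π)} {λ _ → k}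
        (λ π∈ → hit-bound (∈-arrangements⁻ n length-allFin π∈)) ∑-k≤∑-hit {π}
        (∈-arrangements⁺ n length-allFin π↭)

      module _ {π : List (Fin n)} (π↭ : π ↭ allFin n) where

        count-miss : count n (miss π) ≡ l
        count-miss = ≤-antisym (+-cancelˡ-≤ (count n (hit π)) _ _ (≤-trans (≤-reflexive (trans (count-not n (hit π)) (sym k+l≡n)))
          (+-monoˡ-≤ l (saturated π↭)))) (Circ.count-bound π↭)

        gap : ∃[ s ] s < n × miss π s ≡ false
        gap = count-search-false n (miss π) (subst (_< n) (sym count-miss) (≤-trans l<k (<⇒≤ k<n)))

        one-descent : count n (descent (miss π)) ≤ 1
        one-descent = Circ.one-descent π↭ (proj₁ gap , proj₂ (proj₂ gap)) (≤-reflexive count-miss)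

        a-descent : ∃[ s ] miss π s ≡ true × miss π (suc s) ≡ false
        a-descent = let s , _ , eq = count-search n (descent (miss π)) (Circ.some-descent π↭ (proj₁ gap , proj₂ (proj₂ gap)))
                    in s , split (miss π s) (miss π (suc s)) eq
          where
          split : ∀ x y → x ∧ not y ≡ true → x ≡ true × y ≡ false
          split true false _ = refl , refl

      -- Moving the first entry to the back shifts all starting points by one.
      rotate : ∀ t {π} → π ↭ allFin n → ∃[ π′ ] π′ ↭ allFin n × (∀ s → miss π′ s ≡ miss π (s + t))
      rotate zero    {π} π↭ = π , π↭ , λ s → cong (miss π) (sym (+-identityʳ s))
      rotate (suc t) {[]} π↭ with () ← trans (↭-length π↭) length-allFin
      rotate (suc t) {x ∷ xs} π↭ with rotate t (↭-trans (↭-sym (∷↭∷ʳ x xs)) π↭)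
      ... | π′ , π′↭ , eq = π′ , π′↭ , λ s → trans (eq s) (trans (rot (s + t)) (cong (miss (x ∷ xs)) (sym (+-suc s t))))
        where
        length≡ : length xs ≡ n′
        length≡ = suc-injective (trans (↭-length π↭) length-allFin)
        rot : ∀ s → miss (xs ∷ʳ x) s ≡ miss (x ∷ xs) (suc s)
        rot s = cong (not ∘ inFamily) (trans (elementsAt-∷ʳ (coarc s) xs x) (insertIf-cong
          (cong (λ z → not (z <ᵇ l)) (trans (cong (offset n′ s) length≡) (trans (sym (offset-suc n′ s n′)) (offset-periodʳ n′ (suc s) 0))))
          (elementsAt-cong xs (λ p _ → cong (λ z → not (z <ᵇ l)) (sym (offset-suc n′ s p))))))

      -- The arcs in the family are exactly those missing the last element of the arrangement.
      Aligned : List (Fin n) → Set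
      Aligned π = Threshold n k (miss π)

      -- Rotate until a descent falls between position `n′` and position 0. By extremality it is the
      -- only one, so `miss` never falls along the list.
      aligned-exists : ∃[ ys ] ∃[ x ] ys ∷ʳ x ↭ allFin n × Aligned (ys ∷ʳ x)
      aligned-exists =
        let s₀ , on , off = a-descent ↭-refl
            π , π↭ , eq   = rotate (suc s₀) ↭-refl
        in align s₀ on off π↭ eq (initLast π)
        where
        align : ∀ s₀ → miss (allFin n) s₀ ≡ true → miss (allFin n) (suc s₀) ≡ false → ∀ {π} → π ↭ allFin n →
                (∀ s → miss π s ≡ miss (allFin n) (s + suc s₀)) → InitLast π → ∃[ ys ] ∃[ x ] ys ∷ʳ x ↭ allFin n × Aligned (ys ∷ʳ x)
        align s₀ on off π↭ eq []        = contradiction (trans (↭-length π↭) length-allFin) λ ()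
        align s₀ on off π↭ eq (ys ∷ʳ′ x) = ys , x , π↭ , monotone-threshold n k l f k+l≡n mono (count-miss π↭)
          where
          f = miss (ys ∷ʳ x)
          first : f 0 ≡ false
          first = trans (eq 0) off
          last : f n′ ≡ true
          last = trans (eq n′) (trans (cong (miss (allFin n)) (trans (+-suc n′ s₀) (+-comm n s₀))) (trans (miss-period ↭-refl s₀) on))
          mono : ∀ s → suc s < n → f s ≡ true → f (suc s) ≡ true
          mono s s<n fs = not-injective (¬-not λ e → contradiction (one-descent π↭)
            (<⇒≱ (count-≥2 n (descent f) (s≤s⁻¹ s<n) ≤-refl (cong₂ (λ x y → x ∧ not y) fs (not-injective e))
              (cong₂ (λ x y → x ∧ not y) last (trans (miss-period π↭ 0) first)))))

      -- An arc separates neighbours only at its start, which `suc d < n` excludes, or at its end,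
      -- which `suc d ≢ l` excludes.
      arc-step : ∀ s p d {u v} → suc d < n → suc d ≢ l → p + u * n ≡ s + d + v * n → arc n′ l s p ≡ arc n′ l s (suc p)
      arc-step s p d {u} {v} d<n d≢l eq = trans (cong (_<ᵇ l) (offset-unique n′ s p d {u} {v} (<-trans (n<1+n d) d<n) eq))
        (trans (go (d <? l)) (sym (cong (_<ᵇ l) (offset-unique n′ s (suc p) (suc d) {u} {v} d<n (trans (cong suc eq) (cong (_+ v * n) (sym (+-suc s d))))))))
        where
        go : Dec (d < l) → (d <ᵇ l) ≡ (suc d <ᵇ l)
        go (yes d<l) = trans (<ᵇ-true d<l) (sym (<ᵇ-true (≤∧≢⇒< d<l d≢l)))
        go (no d≮l)  = trans (<ᵇ-false (≮⇒≥ d≮l)) (sym (<ᵇ-false (m≤n⇒m≤1+n (≮⇒≥ d≮l))))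

      -- The new arrangement is extremal too, so its `miss` has the same count and at most one
      -- descent; it can differ from the old one at two starting points only, and the stability
      -- lemmas exclude any change.
      aligned-swap : ∀ us x y vs z → (us ++ x ∷ y ∷ vs) ∷ʳ z ↭ allFin n → (us ++ y ∷ x ∷ vs) ∷ʳ z ↭ allFin n →
                     Aligned ((us ++ x ∷ y ∷ vs) ∷ʳ z) → Aligned ((us ++ y ∷ x ∷ vs) ∷ʳ z)
      aligned-swap us x y vs z π↭ ρ↭ thr = go (i <? l)
        where
        π = (us ++ x ∷ y ∷ vs) ∷ʳ z
        ρ = (us ++ y ∷ x ∷ vs) ∷ʳ z
        i = suc (length us)
        i<n′ : i < n′
        i<n′ = s≤s⁻¹ (≤-trans (≤-trans (s≤s (s≤s (s≤s (m≤m+n (length us) (length vs)))))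
          (≤-reflexive (lem (length us) (length vs)))) (≤-reflexive (trans (sym len) (trans (↭-length π↭) length-allFin))))
          where
          lem : ∀ a b → suc (suc (suc (a + b))) ≡ a + suc (suc b) + 1
          lem = solve-∀
          len : length π ≡ length us + suc (suc (length vs)) + 1
          len = trans (length-++ (us ++ x ∷ y ∷ vs)) (cong (_+ 1) (length-++ us))
        same : ∀ s → arc n′ l s (length us) ≡ arc n′ l s i → miss π s ≡ miss ρ s
        same s eq = cong (not ∘ inFamily) (subst₂ (λ a b → elementsAt (coarc s) a ≡ elementsAt (coarc s) b)
          (sym (++-assoc us (x ∷ y ∷ vs) [ z ])) (sym (++-assoc us (y ∷ x ∷ vs) [ z ]))
          (elementsAt-swap (coarc s) us x y (vs ∷ʳ z) (cong not eq)))
        -- Only the arcs starting at i or ending just before i separate the swapped positions.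
        unseparated : ∀ s → s < n → s ≢ i → s + l ≢ i → s + l ≢ i + n → miss π s ≡ miss ρ s
        unseparated s s<n s≢i no₁ no₂ = same s (arcs (s ≤? length us))
          where
          p = length us
          arcs : Dec (s ≤ p) → arc n′ l s p ≡ arc n′ l s i
          arcs (yes s≤p) = arc-step s p (p ∸ s) {0} {0}
            (≤-trans (s≤s (s≤s (m∸n≤m p s))) (<⇒≤ (s≤s i<n′)))
            (λ e → no₁ (trans (cong (s +_) (sym e)) (trans (+-suc s (p ∸ s)) (cong suc (m+[n∸m]≡n s≤p)))))
            (cong (_+ 0) (sym (m+[n∸m]≡n s≤p)))
          arcs (no s≰p) = arc-step s p d {1} {0} d+1<n
            (λ e → no₂ (trans (cong (s +_) (sym e)) (trans (+-suc s d) (cong suc s+d≡))))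
            (trans (cong (p +_) (+-identityʳ n)) (trans (sym s+d≡) (sym (+-identityʳ _))))
            where
            d = p + n ∸ s
            s+d≡ : s + d ≡ p + n
            s+d≡ = m+[n∸m]≡n (≤-trans (<⇒≤ s<n) (m≤n+m n p))
            i<s : i < s
            i<s = ≤∧≢⇒< (≰⇒> s≰p) (≢-sym s≢i)
            d+1<n : suc d < n
            d+1<n = +-cancelˡ-≤ s _ _ (≤-trans (≤-reflexive (trans (+-suc s (suc d)) (trans (cong suc (trans (+-suc s d) (cong suc s+d≡))) refl)))
              (+-monoˡ-≤ n i<s))
        counts : count n (miss π) ≡ count n (miss ρ)
        counts = trans (count-miss π↭) (sym (count-miss ρ↭))
        go : Dec (i < l) → Aligned ρ
        -- The arc ending just before `i` wraps round: its start is `i + n − l`, that is `i + k`.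
        go (yes i<l) = threshold-stable₂ n′ k l k+l≡n l<k (miss π) (miss ρ) thr (miss-period ρ↭ 0) counts (one-descent ρ↭)
          (s≤s z≤n) i<l refl (λ s s<n s≢i s≢j → unseparated s s<n s≢i (λ e → <⇒≢ (≤-trans i<l (m≤n+m l s)) (sym e))
            (λ e → s≢j (+-cancelʳ-≡ l s (i + k) (trans e (trans (cong (i +_) (sym k+l≡n)) (sym (+-assoc i k l)))))))
        go (no i≮l) = threshold-stable₁ n′ k l k+l≡n l<k (miss π) (miss ρ) thr (miss-period ρ↭ 0) counts (one-descent ρ↭)
          {i} {i ∸ l} (m∸n+n≡m (≮⇒≥ i≮l)) i<n′ (λ e → <⇒≢ (∸-monoʳ-< {i} {l} {0} 0<l (≮⇒≥ i≮l)) (sym e))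
          (λ s s<n s≢i s≢j → unseparated s s<n s≢i (λ e → s≢j (trans (sym (m+n∸n≡m s l)) (cong (_∸ l) e)))
            (λ e → <⇒≢ (+-mono-<-≤ s<n (≮⇒≥ i≮l)) (trans e (+-comm i n))))

      -- `zs` collects the entries already passed, so that a swap deep inside the list is seen as an
      -- exchange of neighbours in the whole arrangement. The last entry never moves.
      aligned-resp-↭ : ∀ zs {xs ys} z → xs ↭ ys → (zs ++ xs) ∷ʳ z ↭ allFin n →
                       Aligned ((zs ++ xs) ∷ʳ z) → Aligned ((zs ++ ys) ∷ʳ z)
      aligned-resp-↭ zs z Perm.refl π↭ thr = thr
      aligned-resp-↭ zs z (prep {xs} {ys} x p) π↭ thr = subst (λ w → Aligned (w ∷ʳ z)) (∷ʳ-++ zs x ys)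
        (aligned-resp-↭ (zs ∷ʳ x) z p (subst (λ w → w ∷ʳ z ↭ allFin n) (sym (∷ʳ-++ zs x xs)) π↭)
          (subst (λ w → Aligned (w ∷ʳ z)) (sym (∷ʳ-++ zs x xs)) thr))
      aligned-resp-↭ zs z (swap {xs} {ys} x y p) π↭ thr = subst (λ w → Aligned (w ∷ʳ z)) (eq ys)
        (aligned-resp-↭ (zs ∷ʳ y ∷ʳ x) z p (subst (λ w → w ∷ʳ z ↭ allFin n) (sym (eq xs)) ρ↭)
          (subst (λ w → Aligned (w ∷ʳ z)) (sym (eq xs)) (aligned-swap zs x y xs z π↭ ρ↭ thr)))
        where
        eq : ∀ ws → (zs ∷ʳ y ∷ʳ x) ++ ws ≡ zs ++ y ∷ x ∷ ws
        eq ws = trans (∷ʳ-++ (zs ∷ʳ y) x ws) (∷ʳ-++ zs y (x ∷ ws))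
        ρ↭ : (zs ++ y ∷ x ∷ xs) ∷ʳ z ↭ allFin n
        ρ↭ = ↭-trans (++⁺ʳ [ z ] (++⁺ˡ zs (swap y x ↭-refl))) π↭
      aligned-resp-↭ zs z (Perm.trans p p′) π↭ thr = aligned-resp-↭ zs z p′ (↭-trans (++⁺ʳ [ z ] (++⁺ˡ zs (↭-sym p))) π↭)
        (aligned-resp-↭ zs z p π↭ thr)

      -- Were `x` outside a member `F`, an arrangement could have `F` on its first `k` positions and
      -- still end in `x`. It would be aligned, yet contain in the family a coarc that avoids the
      -- last position.
      aligned-last∈ : ∀ ys x → ys ∷ʳ x ↭ allFin n → Aligned (ys ∷ʳ x) → ∀ {F} → F ∈ members 𝓕 → x Subset.∈ F
      aligned-last∈ ys x π↭ thr {F} F∈ = decidable-stable (x ∈ˢ? F) λ x∉ →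
        let ws , ρ↭ , eq = arrange-with-last F x x∉ in clash ws ρ↭ eq
        where
        clash : ∀ ws → ws ∷ʳ x ↭ allFin n → elementsAt (_<ᵇ ∣ F ∣) (ws ∷ʳ x) ≡ F → Empty.⊥
        clash ws ρ↭ eq = contradiction (trans (sym (cong not (<ᵇ-false {k} ≤-refl))) (trans (sym (thr′ k k<n)) missed)) λ ()
          where
          ∣F∣≡k = All.lookup (uniform 𝓕) F∈
          ρ = ws ∷ʳ x
          thr′ : Aligned ρ
          thr′ = aligned-resp-↭ [] x (drop-∷ (↭-trans (∷↭∷ʳ x ys) (↭-trans π↭ (↭-trans (↭-sym ρ↭) (↭-sym (∷↭∷ʳ x ws)))))) π↭ thr
          coarc-k : ∀ p → p < length ρ → coarc k p ≡ (p <ᵇ ∣ F ∣)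
          coarc-k p p<ρ with p <? k
          ... | yes p<k = trans (cong not (<ᵇ-false (subst (l ≤_) (sym (offset-unique n′ k p (p + l) {1} {0} (≤-trans (+-monoˡ-< l p<k) (≤-reflexive k+l≡n)) (trans (cong (λ z → p + (z + 0)) (sym k+l≡n)) (lem p k l)))) (m≤n+m l p))))
                  (sym (<ᵇ-true (subst (p <_) (sym ∣F∣≡k) p<k)))
            where
            lem : ∀ p k l → p + (k + l + 0) ≡ k + (p + l) + 0
            lem = solve-∀
          ... | no  p≮k = trans (cong not (<ᵇ-true (subst (_< l) (sym (offset-unique n′ k p (p ∸ k) {0} {0} (≤-trans p-k<l l≤n) (cong (_+ 0) (sym k+[p-k])))) p-k<l)))
                  (sym (<ᵇ-false (subst (_≤ p) (sym ∣F∣≡k) (≮⇒≥ p≮k))))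
            where
            k+[p-k] : k + (p ∸ k) ≡ p
            k+[p-k] = m+[n∸m]≡n (≮⇒≥ p≮k)
            p-k<l : p ∸ k < l
            p-k<l = +-cancelˡ-≤ k _ _ (≤-trans (≤-reflexive (trans (+-suc k (p ∸ k)) (cong suc k+[p-k]))) (≤-trans p<ρ (≤-reflexive (trans (↭-length ρ↭) (trans length-allFin (sym k+l≡n))))))
          missed : miss ρ k ≡ false
          missed = trans (cong (not ∘ inFamily) (trans (elementsAt-cong ρ coarc-k) eq)) (cong not (dec-true (F ∈?.∈? members 𝓕) F∈))

      star : ∃[ x ] ∀ {F} → F ∈ members 𝓕 → x Subset.∈ F
      star = let ys , x , π↭ , thr = aligned-exists in x , aligned-last∈ ys x π↭ thr

    size<star : size 𝓕 < n′ C k₁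
    size<star = ≰⇒> λ large → nonTrivial (proj₁ (star large) , x∈⋂⁺ (members 𝓕) (proj₂ (star large)))

  -- Existence of the maximum

  ∣kSubset∣ : ∀ n k → All (λ S → ∣ S ∣ ≡ k) (kSubsets n k)
  ∣kSubset∣ zero    zero    = refl ∷ []
  ∣kSubset∣ zero    (suc k) = []
  ∣kSubset∣ (suc n) zero    = All.map⁺ (∣kSubset∣ n zero)
  ∣kSubset∣ (suc n) (suc k) = All.++⁺ (All.map⁺ (All.map (cong suc) (∣kSubset∣ n k))) (All.map⁺ (∣kSubset∣ n (suc k)))

  kSubsets-unique : ∀ n k → Unique (kSubsets n k)
  kSubsets-unique zero    zero    = [] ∷ []
  kSubsets-unique zero    (suc k) = []
  kSubsets-unique (suc n) zero    = Unique.map⁺ Vec.∷-injectiveʳ (kSubsets-unique n zero)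
  kSubsets-unique (suc n) (suc k) = Unique.++⁺
    (Unique.map⁺ Vec.∷-injectiveʳ (kSubsets-unique n k)) (Unique.map⁺ Vec.∷-injectiveʳ (kSubsets-unique n (suc k)))
    λ (S∈ , T∈) → clash (∈-map⁻ _ S∈) (∈-map⁻ _ T∈)
    where
    clash : ∀ {S : Subset (suc n)} {P Q : Subset n → Set} → ∃[ A ] (P A × S ≡ inside ∷ A) → ∃[ B ] (Q B × S ≡ outside ∷ B) → Empty.⊥
    clash (_ , _ , refl) (_ , _ , ())

  -- `S` accumulates the intersection of the sets already chosen; recursion on `r` replaces the
  -- quantifier over functions by nested quantifiers over the list `L`.
  intersecting? : ∀ {n} (L : List (Subset n)) r (S : Subset n) →
                  Dec ((F : Fin r → Subset n) → (∀ i → F i ∈ L) → Nonempty (S ∩ ⋂ (tabulate F)))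
  intersecting? L zero    S = map′ (λ ne _ _ → ne) (λ h → h (λ ()) (λ ())) (nonempty? (S ∩ ⊤))
  intersecting? {n} L (suc r) S = map′
    (λ all F F∈ → subst Nonempty (∩-assoc S (F zero) _) (All.lookup all (F∈ zero) (F ∘ suc) (F∈ ∘ suc)))
    (λ h → All.tabulate λ {A} A∈ F F∈ → subst Nonempty (sym (∩-assoc S A _))
       (h (cons A F) (λ { zero → A∈ ; (suc i) → F∈ i })))
    (All.all? (λ A → intersecting? L r (S ∩ A)) L)
    where
    cons : Subset n → (Fin r → Subset n) → Fin (suc r) → Subset n
    cons A F zero    = A
    cons A F (suc i) = F i

  sublists : ∀ {A : Set} → List A → List (List A)
  sublists []       = [] ∷ []
  sublists (x ∷ xs) = map (x ∷_) (sublists xs) ++ sublists xs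

  filter∈sublists : ∀ {A : Set} {P : A → Set} (P? : Decidable P) xs → filter P? xs ∈ sublists xs
  filter∈sublists P? []       = here refl
  filter∈sublists P? (x ∷ xs) with does (P? x)
  ... | true  = ∈-++⁺ˡ (∈-map⁺ (x ∷_) (filter∈sublists P? xs))
  ... | false = ∈-++⁺ʳ (map (x ∷_) (sublists xs)) (filter∈sublists P? xs)

  module _ (r : ℕ) {n k : ℕ} where

    private
      module ∈? = DecMembership (_≟ˢ_ {n})

    Admissible : Family n k → Set
    Admissible 𝓕 = Intersecting r 𝓕 × NonTrivial 𝓕

    admissible? : Decidable Admissible
    admissible? 𝓕 = map′
        (λ h F F∈ → subst Nonempty (∩-identityˡ _) (h F F∈))
        (λ h F F∈ → subst Nonempty (sym (∩-identityˡ _)) (h F F∈))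
        (intersecting? (members 𝓕) r ⊤)
      ×-dec ¬? (nonempty? (⋂ (members 𝓕)))

    admissible-resp : ∀ {𝓕 𝓖 : Family n k} → (∀ {S} → S ∈ members 𝓕 → S ∈ members 𝓖) →
                      (∀ {S} → S ∈ members 𝓖 → S ∈ members 𝓕) → Admissible 𝓕 → Admissible 𝓖
    admissible-resp {𝓕} {𝓖} to from (int , nt) = (λ F F∈ → int F (from ∘ F∈)) ,
      λ (x , x∈) → nt (x , x∈⋂⁺ (members 𝓕) (λ S∈ → x∈⋂⁻ (members 𝓖) x∈ (to S∈)))

    -- A canonical form: every family has the same members as `restrict L` for some sublist `L` of
    -- `kSubsets n k`, so finitely many candidates suffice.
    restrict : List (Subset n) → Family n k
    restrict L = record
      { members = filter (λ S → S ∈?.∈? L) (kSubsets n k)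
      ; unique  = Unique.filter⁺ (λ S → S ∈?.∈? L) (kSubsets-unique n k)
      ; uniform = All.filter⁺ (λ S → S ∈?.∈? L) (∣kSubset∣ n k)
      }

    maximum-exists : (𝓕₀ : Family n k) → Admissible 𝓕₀ →
                     ∃[ 𝓜 ] Admissible 𝓜 × (∀ 𝓕 → Admissible 𝓕 → size 𝓕 ≤ size 𝓜)
    maximum-exists 𝓕₀ adm₀ = best , argmax-all size {P = Admissible} adm₀ (All.all-filter admissible? candidates) , bound
      where
      candidates = map restrict (sublists (kSubsets n k))
      -- The given admissible family is the default value; in the application the lower-bound
      -- construction provides it.
      best = argmax size 𝓕₀ (filter admissible? candidates)
      bound : ∀ 𝓕 → Admissible 𝓕 → size 𝓕 ≤ size best
      bound 𝓕 adm = ≤-trans (length-mono-⊆ _≟ˢ_ (unique 𝓕) to)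
        (All.lookup (f[xs]≤f[argmax] {f = size} 𝓕₀ (filter admissible? candidates))
          (∈-filter⁺ admissible? (∈-map⁺ restrict (filter∈sublists (λ S → S ∈?.∈? members 𝓕) (kSubsets n k)))
            (admissible-resp {𝓕} {𝓖} to from adm)))
        where
        L = filter (λ S → S ∈?.∈? members 𝓕) (kSubsets n k)
        𝓖 = restrict L
        to : ∀ {S} → S ∈ members 𝓕 → S ∈ members 𝓖
        to {S} S∈ = ∈-filter⁺ (λ S → S ∈?.∈? L) S∈k (∈-filter⁺ (λ S → S ∈?.∈? members 𝓕) S∈k S∈)
          where
          S∈k = subst (λ j → S ∈ kSubsets n j) (All.lookup (uniform 𝓕) S∈) (∈-kSubsets S)
        from : ∀ {S} → S ∈ members 𝓖 → S ∈ members 𝓕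
        from S∈ = proj₂ (∈-filter⁻ (λ S → S ∈?.∈? members 𝓕) {xs = kSubsets n k} (proj₂ (∈-filter⁻ (λ S → S ∈?.∈? L) {xs = kSubsets n k} S∈)))

  -- The lower bound

  length-filter-∑ : ∀ {A : Set} {P : A → Set} (P? : Decidable P) xs → length (filter P? xs) ≡ ∑[ x ∈ xs ] 𝟙 (does (P? x))
  length-filter-∑ P? []       = refl
  length-filter-∑ P? (x ∷ xs) with does (P? x)
  ... | true  = cong suc (length-filter-∑ P? xs)
  ... | false = length-filter-∑ P? xs

  initial : ℕ → ∀ N → Subset N
  initial zero    N       = ⊥
  initial (suc a) zero    = []
  initial (suc a) (suc N) = inside ∷ initial a N

  ∣initial∣ : ∀ {a N} → a ≤ N → ∣ initial a N ∣ ≡ a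
  ∣initial∣ {zero}  {N} z≤n       = ∣⊥∣≡0 N
  ∣initial∣ {suc a}     (s≤s a≤N) = cong suc (∣initial∣ a≤N)

  -- shiftedC h n l is the number of ways to extend a fixed h-set to an l-subset of an n-set.
  shiftedC : ℕ → ℕ → ℕ → ℕ
  shiftedC zero    n       l       = n C l
  shiftedC (suc h) zero    l       = 0
  shiftedC (suc h) (suc n) zero    = 0
  shiftedC (suc h) (suc n) (suc l) = shiftedC h n l

  shiftedC-0 : ∀ h n → shiftedC (suc h) n 0 ≡ 0
  shiftedC-0 h zero    = refl
  shiftedC-0 h (suc n) = refl

  shiftedC-pascal : ∀ {h n} l → h ≤ n → shiftedC h n l + shiftedC h n (suc l) ≡ shiftedC h (suc n) (suc l)
  shiftedC-pascal {zero}  {n} l z≤n = nCk+nC[k+1]≡[n+1]C[k+1] n l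
  shiftedC-pascal {suc zero}    {suc n} zero (s≤s le) = refl
  shiftedC-pascal {suc (suc h)} {suc n} zero (s≤s le) = shiftedC-0 h n
  shiftedC-pascal {suc h} {suc n} (suc l) (s≤s le) = shiftedC-pascal l le

  -- Both sides count the pairs of an l-set `R` and an h-subset of its trace on the first `a`
  -- points. For `h` equal to 1 and 2 these are, up to scaling, the factorial moments of the
  -- hypergeometric distribution.
  ∑-binomial-moment : ∀ h {a N} l → a ≤ N → ∑[ R ∈ kSubsets N l ] (∣ initial a N ∩ R ∣ C h) ≡ (a C h) * shiftedC h N l
  ∑-binomial-moment h {zero} {N} l z≤n = begin
    ∑[ R ∈ kSubsets N l ] (∣ ⊥ ∩ R ∣ C h) ≡⟨ ∑-cong (kSubsets N l) (λ R → cong (_C h) (trans (cong ∣_∣ (∩-zeroˡ R)) (∣⊥∣≡0 N))) ⟩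
    ∑[ R ∈ kSubsets N l ] (0 C h) ≡⟨ ∑-const (kSubsets N l) (0 C h) ⟩
    length (kSubsets N l) * (0 C h) ≡⟨ cong (_* (0 C h)) (length-kSubsets N l) ⟩
    (N C l) * (0 C h) ≡⟨ go h ⟩
    (0 C h) * shiftedC h N l ∎
    where
    open ≡-Reasoning
    go : ∀ h → (N C l) * (0 C h) ≡ (0 C h) * shiftedC h N l
    go zero    = *-comm (N C l) 1
    go (suc h) rewrite k>n⇒nCk≡0 {0} {suc h} (s≤s z≤n) = *-zeroʳ (N C l)
  ∑-binomial-moment h {suc a} {suc N} zero (s≤s a≤N) = trans (∑-map (outside ∷_) (kSubsets N 0) _)
    (trans (∑-binomial-moment h zero a≤N) (go h))
    where
    go : ∀ h → (a C h) * shiftedC h N 0 ≡ (suc a C h) * shiftedC h (suc N) 0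
    go zero    = refl
    go (suc h) = trans (cong ((a C suc h) *_) (shiftedC-0 h N)) (trans (*-zeroʳ (a C suc h)) (sym (*-zeroʳ (suc a C suc h))))
  ∑-binomial-moment zero {suc a} {suc N} (suc l) (s≤s a≤N) = begin
    ∑[ R ∈ kSubsets (suc N) (suc l) ] 1 ≡⟨ trans (∑-const (kSubsets (suc N) (suc l)) 1) (*-comm _ 1) ⟩
    1 * length (kSubsets (suc N) (suc l)) ≡⟨ cong (1 *_) (length-kSubsets (suc N) (suc l)) ⟩
    1 * (suc N C suc l) ∎
    where open ≡-Reasoning
  ∑-binomial-moment (suc h) {suc a} {suc N} (suc l) (s≤s a≤N) = begin
    _ ≡⟨ ∑-++ (map (inside ∷_) (kSubsets N l)) _ _ ⟩
    _ ≡⟨ cong₂ _+_ (∑-map (inside ∷_) (kSubsets N l) _) (∑-map (outside ∷_) (kSubsets N (suc l)) _) ⟩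
    ∑[ R ∈ kSubsets N l ] (suc (Y R) C suc h) + ∑[ R ∈ kSubsets N (suc l) ] (Y R C suc h)
      ≡⟨ cong (_+ ∑[ R ∈ kSubsets N (suc l) ] (Y R C suc h)) (trans
           (∑-cong (kSubsets N l) (λ R → sym (nCk+nC[k+1]≡[n+1]C[k+1] (Y R) h))) (∑-+ (kSubsets N l) (λ R → Y R C h) (λ R → Y R C suc h))) ⟩
    ∑[ R ∈ kSubsets N l ] (Y R C h) + ∑[ R ∈ kSubsets N l ] (Y R C suc h) + ∑[ R ∈ kSubsets N (suc l) ] (Y R C suc h)
      ≡⟨ cong₂ _+_ (cong₂ _+_ (∑-binomial-moment h l a≤N) (∑-binomial-moment (suc h) l a≤N)) (∑-binomial-moment (suc h) (suc l) a≤N) ⟩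
    (a C h) * S + (a C suc h) * shiftedC (suc h) N l + (a C suc h) * shiftedC (suc h) N (suc l)
      ≡⟨ trans (+-assoc ((a C h) * S) _ _) (cong ((a C h) * S +_) (trans (sym (*-distribˡ-+ (a C suc h) _ _)) pascal)) ⟩
    (a C h) * S + (a C suc h) * S ≡⟨ sym (*-distribʳ-+ S (a C h) (a C suc h)) ⟩
    (a C h + a C suc h) * S ≡⟨ cong (_* S) (nCk+nC[k+1]≡[n+1]C[k+1] a h) ⟩
    (suc a C suc h) * S ∎
    where
    open ≡-Reasoning
    Y : Subset N → ℕ
    Y R = ∣ initial a N ∩ R ∣
    S = shiftedC h N l
    pascal : (a C suc h) * (shiftedC (suc h) N l + shiftedC (suc h) N (suc l)) ≡ (a C suc h) * S
    pascal with suc h ≤? N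
    ... | yes h<N = cong ((a C suc h) *_) (shiftedC-pascal {suc h} l h<N)
    ... | no  h≮N rewrite k>n⇒nCk≡0 {a} {suc h} (≤-trans (s≤s a≤N) (≰⇒> h≮N)) = refl

  shiftedC-1 : ∀ N l → N * shiftedC 1 N l ≡ l * (N C l)
  shiftedC-1 zero    zero    = refl
  shiftedC-1 zero    (suc l) = sym (trans (cong (suc l *_) (k>n⇒nCk≡0 {0} {suc l} (s≤s z≤n))) (*-zeroʳ (suc l)))
  shiftedC-1 (suc N) zero    = *-zeroʳ (suc N)
  shiftedC-1 (suc N) (suc l) = sym (absorption N l)

  -- The exact factor is `l * (l ∸ 1)`; rounding it up still bounds the variance by the mean.
  shiftedC-2 : ∀ N l → N * (N ∸ 1) * shiftedC 2 N l ≤ l * l * (N C l)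
  shiftedC-2 zero    l       = z≤n
  shiftedC-2 (suc N) zero    = ≤-reflexive (*-zeroʳ (suc N * N))
  shiftedC-2 (suc N) (suc l) = begin
    suc N * N * shiftedC 1 N l     ≡⟨ *-assoc (suc N) N _ ⟩
    suc N * (N * shiftedC 1 N l)   ≡⟨ cong (suc N *_) (shiftedC-1 N l) ⟩
    suc N * (l * (N C l))          ≡⟨ lem (suc N) l (N C l) ⟩
    l * (suc N * (N C l))          ≡⟨ cong (l *_) (sym (absorption N l)) ⟩
    l * (suc l * (suc N C suc l))  ≤⟨ *-monoˡ-≤ (suc l * (suc N C suc l)) (n≤1+n l) ⟩
    suc l * (suc l * (suc N C suc l)) ≡⟨ sym (*-assoc (suc l) (suc l) _) ⟩
    suc l * suc l * (suc N C suc l) ∎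
    where
    open ≤-Reasoning
    lem : ∀ a b c → a * (b * c) ≡ b * (a * c)
    lem = solve-∀

  2*nC2 : ∀ n → 2 * (n C 2) ≡ n * (n ∸ 1)
  2*nC2 zero          = refl
  2*nC2 (suc n) = trans (absorption n 1) (cong (suc n *_) (nC1≡n n))

  square-C2 : ∀ y → y * y ≡ 2 * (y C 2) + y
  square-C2 zero    = refl
  square-C2 (suc y) = trans (lem y) (cong (_+ suc y) (sym (2*nC2 (suc y))))
    where
    lem : ∀ y → suc y * suc y ≡ suc y * y + suc y
    lem = solve-∀

  -- The inequality (x - y)² ≥ d², multiplied out.
  gap-square : ∀ x y d → y + d ≤ x → 2 * (x * y) + d * d ≤ x * x + y * y
  gap-square x y d le = subst (λ x → 2 * (x * y) + d * d ≤ x * x + y * y) (m+[n∸m]≡n le)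
    (≤-trans (m≤m+n _ (2 * (d * e) + e * e)) (≤-reflexive (lem y d e)))
    where
    e = x ∸ (y + d)
    lem : ∀ y d e → 2 * ((y + d + e) * y) + d * d + (2 * (d * e) + e * e) ≡ (y + d + e) * (y + d + e) + y * y
    lem = solve-∀

  2xy≤x²+y² : ∀ x y → 2 * (x * y) ≤ x * x + y * y
  2xy≤x²+y² x y with ≤-total y x
  ... | inj₁ y≤x = ≤-trans (m≤m+n _ 0) (gap-square x y 0 (≤-trans (≤-reflexive (+-identityʳ y)) y≤x))
  ... | inj₂ x≤y = subst₂ _≤_ (cong (2 *_) (*-comm y x)) (+-comm (y * y) (x * x))
                     (≤-trans (m≤m+n _ 0) (gap-square y x 0 (≤-trans (≤-reflexive (+-identityʳ x)) x≤y)))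

  -- Chebyshev's inequality for the hypergeometric distribution: Y has mean k l / N, and R is bad when Y R ≥ k / ρ.
  module Concentration (N k l ρ g : ℕ) (k≤N : k ≤ N) (N≡ : ρ * l + g ≡ N) where

    Y : Subset N → ℕ
    Y R = ∣ initial k N ∩ R ∣

    bad : ℕ
    bad = ∑[ R ∈ kSubsets N l ] 𝟙 (does (k ≤? ρ * Y R))

    private
      K = kSubsets N l
      c = N C l

      -- ρ²(N Y − k l)² is nonnegative, and at least (k g)² when R is bad; expanded so that no subtraction occurs.
      pointwise : ∀ R → 2 * (ρ * ρ * N * k * l) * Y R + (k * g) * (k * g) * 𝟙 (does (k ≤? ρ * Y R)) ≤
                        ρ * ρ * N * N * (2 * (Y R C 2) + Y R) + ρ * ρ * k * k * l * l
      pointwise R = subst (λ z → 2 * (ρ * ρ * N * k * l) * y + (k * g) * (k * g) * 𝟙 (does (k ≤? ρ * y)) ≤ ρ * ρ * N * N * z + ρ * ρ * k * k * l * l)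
        (square-C2 y) (go (k ≤? ρ * y))
        where
        y = Y R
        lem₁ : ∀ ρ N k l y g → 2 * (ρ * ρ * N * k * l) * y + (k * g) * (k * g) * 1 ≡ 2 * ((N * (ρ * y)) * (ρ * l * k)) + (k * g) * (k * g)
        lem₁ = solve-∀
        lem₀ : ∀ ρ N k l y g → 2 * (ρ * ρ * N * k * l) * y + (k * g) * (k * g) * 0 ≡ 2 * ((N * (ρ * y)) * (ρ * l * k))
        lem₀ = solve-∀
        lem₂ : ∀ ρ N k l y → (N * (ρ * y)) * (N * (ρ * y)) + (ρ * l * k) * (ρ * l * k) ≡ ρ * ρ * N * N * (y * y) + ρ * ρ * k * k * l * l
        lem₂ = solve-∀
        go : (d : Dec (k ≤ ρ * y)) → 2 * (ρ * ρ * N * k * l) * y + (k * g) * (k * g) * 𝟙 (does d) ≤ ρ * ρ * N * N * (y * y) + ρ * ρ * k * k * l * l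
        go (yes le) = begin
          _ ≡⟨ lem₁ ρ N k l y g ⟩
          -- `N = ρ * l + g` splits `N * k` into `ρ * l * k` and `k * g`, so badness, `k ≤ ρ * y`,
          -- separates the two terms by `k * g`.
          _ ≤⟨ gap-square (N * (ρ * y)) (ρ * l * k) (k * g) (≤-trans (≤-reflexive (trans (cong (ρ * l * k +_) (*-comm k g)) (trans (sym (*-distribʳ-+ k (ρ * l) g)) (cong (_* k) N≡)))) (*-monoʳ-≤ N le)) ⟩
          _ ≡⟨ lem₂ ρ N k l y ⟩
          _ ∎
          where open ≤-Reasoning
        go (no _) = begin
          _ ≡⟨ lem₀ ρ N k l y g ⟩
          _ ≤⟨ 2xy≤x²+y² (N * (ρ * y)) (ρ * l * k) ⟩
          _ ≡⟨ lem₂ ρ N k l y ⟩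
          _ ∎
          where open ≤-Reasoning

      M₁ : ∑ K Y ≡ k * shiftedC 1 N l
      M₁ = trans (∑-cong K (λ R → sym (nC1≡n (Y R)))) (trans (∑-binomial-moment 1 l k≤N) (cong (_* shiftedC 1 N l) (nC1≡n k)))

      N*M₁ : N * ∑ K Y ≡ k * (l * c)
      N*M₁ = trans (cong (N *_) M₁) (trans (lem N k _) (cong (k *_) (shiftedC-1 N l)))
        where
        lem : ∀ a b c → a * (b * c) ≡ b * (a * c)
        lem = solve-∀

      M₂ : ∑[ R ∈ K ] (2 * (Y R C 2)) ≡ k * (k ∸ 1) * shiftedC 2 N l
      M₂ = trans (∑-*ˡ K 2 _) (trans (cong (2 *_) (∑-binomial-moment 2 l k≤N))
        (trans (sym (*-assoc 2 (k C 2) _)) (cong (_* shiftedC 2 N l) (2*nC2 k))))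

      ratio : N * (k ∸ 1) ≤ k * (N ∸ 1)
      ratio = subst₂ _≤_ (sym (*-distribˡ-∸ N k 1)) (trans (cong₂ _∸_ (*-comm N k) (sym (*-identityʳ k))) (sym (*-distribˡ-∸ k N 1)))
        (∸-monoʳ-≤ (N * k) (≤-trans k≤N (≤-reflexive (sym (*-identityʳ N)))))

      -- Drawing without replacement makes the hits negatively correlated: the second factorial
      -- moment is at most the square of the mean.
      N²M₂ : N * N * (∑[ R ∈ K ] (2 * (Y R C 2))) ≤ k * k * (l * l * c)
      N²M₂ = begin
        N * N * (∑[ R ∈ K ] (2 * (Y R C 2)))          ≡⟨ cong (N * N *_) M₂ ⟩
        N * N * (k * (k ∸ 1) * shiftedC 2 N l)      ≡⟨ lem₁ N k (k ∸ 1) _ ⟩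
        N * (k ∸ 1) * (N * k * shiftedC 2 N l)      ≤⟨ *-monoˡ-≤ (N * k * shiftedC 2 N l) ratio ⟩
        k * (N ∸ 1) * (N * k * shiftedC 2 N l)      ≡⟨ lem₂ N k (N ∸ 1) _ ⟩
        k * k * (N * (N ∸ 1) * shiftedC 2 N l)      ≤⟨ *-monoʳ-≤ (k * k) (shiftedC-2 N l) ⟩
        k * k * (l * l * c)                         ∎
        where
        open ≤-Reasoning
        lem₁ : ∀ N k j s → N * N * (k * j * s) ≡ N * j * (N * k * s)
        lem₁ = solve-∀
        lem₂ : ∀ N k j s → k * j * (N * k * s) ≡ k * k * (N * j * s)
        lem₂ = solve-∀

    -- Sum `pointwise` over all `R`. The squares of the mean cancel, and what is left of the
    -- variance is at most the mean.
    chebyshev : (k * g) * (k * g) * bad ≤ ρ * ρ * N * k * l * c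
    chebyshev = +-cancelˡ-≤ (2 * (ρ * ρ * k * k * l * l * c)) _ _ (begin
      2 * (ρ * ρ * k * k * l * l * c) + (k * g) * (k * g) * bad
        ≡⟨ cong (_+ (k * g) * (k * g) * bad) (trans (lem₁ ρ k l c) (trans (cong (2 * (ρ * ρ * k * l) *_) (sym N*M₁)) (lem₂ ρ k l N (∑ K Y)))) ⟩
      2 * (ρ * ρ * N * k * l) * ∑ K Y + (k * g) * (k * g) * bad
        ≡⟨ sym (trans (∑-+ K _ _) (cong₂ _+_ (∑-*ˡ K (2 * (ρ * ρ * N * k * l)) Y) (∑-*ˡ K ((k * g) * (k * g)) _))) ⟩
      ∑[ R ∈ K ] (2 * (ρ * ρ * N * k * l) * Y R + (k * g) * (k * g) * 𝟙 (does (k ≤? ρ * Y R)))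
        ≤⟨ ∑-mono∈ K (λ {R} _ → pointwise R) ⟩
      ∑[ R ∈ K ] (ρ * ρ * N * N * (2 * (Y R C 2) + Y R) + ρ * ρ * k * k * l * l)
        ≡⟨ trans (∑-+ K _ _) (cong₂ _+_ (trans (∑-*ˡ K (ρ * ρ * N * N) _) (cong (ρ * ρ * N * N *_) (∑-+ K (λ R → 2 * (Y R C 2)) Y)))
             (trans (∑-const K _) (cong (_* (ρ * ρ * k * k * l * l)) (length-kSubsets N l)))) ⟩
      ρ * ρ * N * N * (∑[ R ∈ K ] (2 * (Y R C 2)) + ∑ K Y) + c * (ρ * ρ * k * k * l * l)
        ≡⟨ lem₃ ρ N (∑[ R ∈ K ] (2 * (Y R C 2))) (∑ K Y) (c * (ρ * ρ * k * k * l * l)) ⟩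
      ρ * ρ * (N * N * (∑[ R ∈ K ] (2 * (Y R C 2)))) + ρ * ρ * N * (N * ∑ K Y) + c * (ρ * ρ * k * k * l * l)
        ≤⟨ +-monoˡ-≤ (c * (ρ * ρ * k * k * l * l)) (+-mono-≤ (*-monoʳ-≤ (ρ * ρ) N²M₂) (≤-reflexive (cong (ρ * ρ * N *_) N*M₁))) ⟩
      ρ * ρ * (k * k * (l * l * c)) + ρ * ρ * N * (k * (l * c)) + c * (ρ * ρ * k * k * l * l)
        ≡⟨ lem₄ ρ N k l c ⟩
      2 * (ρ * ρ * k * k * l * l * c) + ρ * ρ * N * k * l * c ∎)
      where
      open ≤-Reasoning
      lem₁ : ∀ ρ k l c → 2 * (ρ * ρ * k * k * l * l * c) ≡ 2 * (ρ * ρ * k * l) * (k * (l * c))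
      lem₁ = solve-∀
      lem₂ : ∀ ρ k l N s → 2 * (ρ * ρ * k * l) * (N * s) ≡ 2 * (ρ * ρ * N * k * l) * s
      lem₂ = solve-∀
      lem₃ : ∀ ρ N a b e → ρ * ρ * N * N * (a + b) + e ≡ ρ * ρ * (N * N * a) + ρ * ρ * N * (N * b) + e
      lem₃ = solve-∀
      lem₄ : ∀ ρ N k l c → ρ * ρ * (k * k * (l * l * c)) + ρ * ρ * N * (k * (l * c)) + c * (ρ * ρ * k * k * l * l) ≡
               2 * (ρ * ρ * k * k * l * l * c) + ρ * ρ * N * k * l * c
      lem₄ = solve-∀

  -- How much of a fixed set an intersection loses

  ∣A∩∁[S∩T]∣≤ : ∀ {n} (A S T : Subset n) → ∣ A ∩ ∁ (S ∩ T) ∣ ≤ ∣ A ∩ ∁ S ∣ + ∣ A ∩ ∁ T ∣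
  ∣A∩∁[S∩T]∣≤ [] [] [] = z≤n
  ∣A∩∁[S∩T]∣≤ (false ∷ A) (_     ∷ S) (_     ∷ T) = ∣A∩∁[S∩T]∣≤ A S T
  ∣A∩∁[S∩T]∣≤ (true  ∷ A) (true  ∷ S) (true  ∷ T) = ∣A∩∁[S∩T]∣≤ A S T
  ∣A∩∁[S∩T]∣≤ (true  ∷ A) (true  ∷ S) (false ∷ T) = ≤-trans (s≤s (∣A∩∁[S∩T]∣≤ A S T)) (≤-reflexive (sym (+-suc _ _)))
  ∣A∩∁[S∩T]∣≤ (true  ∷ A) (false ∷ S) (true  ∷ T) = s≤s (∣A∩∁[S∩T]∣≤ A S T)
  ∣A∩∁[S∩T]∣≤ (true  ∷ A) (false ∷ S) (false ∷ T) = s≤s (≤-trans (∣A∩∁[S∩T]∣≤ A S T) (+-monoʳ-≤ ∣ A ∩ ∁ S ∣ (n≤1+n _)))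

  ∁-involutive : ∀ {n} (S : Subset n) → ∁ (∁ S) ≡ S
  ∁-involutive []      = refl
  ∁-involutive (b ∷ S) = cong₂ _∷_ (not-involutive b) (∁-involutive S)

  ∣A∩∁⊤∣≡0 : ∀ {n} (A : Subset n) → ∣ A ∩ ∁ ⊤ ∣ ≡ 0
  ∣A∩∁⊤∣≡0 []          = refl
  ∣A∩∁⊤∣≡0 (true  ∷ A) = ∣A∩∁⊤∣≡0 A
  ∣A∩∁⊤∣≡0 (false ∷ A) = ∣A∩∁⊤∣≡0 A

  ∣A∩∁A∣≡0 : ∀ {n} (A : Subset n) → ∣ A ∩ ∁ A ∣ ≡ 0
  ∣A∩∁A∣≡0 []          = refl
  ∣A∩∁A∣≡0 (true  ∷ A) = ∣A∩∁A∣≡0 A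
  ∣A∩∁A∣≡0 (false ∷ A) = ∣A∩∁A∣≡0 A

  ∣p∪⁅x⁆∣≡1+∣p∣ : ∀ {n} (p : Subset n) {x} → x Subset.∉ p → ∣ p ∪ ⁅ x ⁆ ∣ ≡ suc ∣ p ∣
  ∣p∪⁅x⁆∣≡1+∣p∣ (true  ∷ p) {zero}  x∉ = contradiction Vec.here x∉
  ∣p∪⁅x⁆∣≡1+∣p∣ (false ∷ p) {zero}  x∉ = cong (suc ∘ ∣_∣) (∪-identityʳ p)
  ∣p∪⁅x⁆∣≡1+∣p∣ (true  ∷ p) {suc x} x∉ = cong suc (∣p∪⁅x⁆∣≡1+∣p∣ p (x∉ ∘ Vec.there))
  ∣p∪⁅x⁆∣≡1+∣p∣ (false ∷ p) {suc x} x∉ = ∣p∪⁅x⁆∣≡1+∣p∣ p (x∉ ∘ Vec.there)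

  module _ {n ρ k : ℕ} (A : Subset n) where

    deficit-bound : ∀ L → (∀ {S} → S ∈ L → ρ * ∣ A ∩ ∁ S ∣ ≤ k) → ρ * ∣ A ∩ ∁ (⋂ L) ∣ ≤ length L * k
    deficit-bound []      _  = ≤-reflexive (trans (cong (ρ *_) (∣A∩∁⊤∣≡0 A)) (*-zeroʳ ρ))
    deficit-bound (S ∷ L) le = ≤-trans (*-monoʳ-≤ ρ (∣A∩∁[S∩T]∣≤ A S (⋂ L)))
      (≤-trans (≤-reflexive (*-distribˡ-+ ρ ∣ A ∩ ∁ S ∣ _)) (+-mono-≤ (le (here refl)) (deficit-bound L (le ∘ there))))

    -- `A` loses nothing to itself, so its occurrence in `L` saves one share `k`.
    deficit-bound-∈ : ∀ L → (∀ {S} → S ∈ L → ρ * ∣ A ∩ ∁ S ∣ ≤ k) → A ∈ L → k + ρ * ∣ A ∩ ∁ (⋂ L) ∣ ≤ length L * k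
    deficit-bound-∈ (S ∷ L) le (here refl) = +-monoʳ-≤ k (≤-trans (*-monoʳ-≤ ρ (≤-trans (∣A∩∁[S∩T]∣≤ A A (⋂ L))
      (≤-reflexive (cong (_+ ∣ A ∩ ∁ (⋂ L) ∣) (∣A∩∁A∣≡0 A))))) (deficit-bound L (le ∘ there)))
    deficit-bound-∈ (S ∷ L) le (there A∈) = begin
      k + ρ * ∣ A ∩ ∁ (S ∩ ⋂ L) ∣                            ≤⟨ +-monoʳ-≤ k (*-monoʳ-≤ ρ (∣A∩∁[S∩T]∣≤ A S (⋂ L))) ⟩
      k + ρ * (∣ A ∩ ∁ S ∣ + ∣ A ∩ ∁ (⋂ L) ∣)                ≡⟨ lem k ρ ∣ A ∩ ∁ S ∣ _ ⟩
      ρ * ∣ A ∩ ∁ S ∣ + (k + ρ * ∣ A ∩ ∁ (⋂ L) ∣)            ≤⟨ +-mono-≤ (le (here refl)) (deficit-bound-∈ L (le ∘ there) A∈) ⟩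
      k + length L * k                                      ∎
      where
      open ≤-Reasoning
      lem : ∀ k r a b → k + r * (a + b) ≡ r * a + (k + r * b)
      lem = solve-∀

  module HiltonMilner (N k₁ l₁ ρ₁ g : ℕ) (N≡ : k₁ + suc l₁ ≡ N) (ρ<k : suc ρ₁ < suc k₁) (gap : suc ρ₁ * suc l₁ + g ≡ N) where

    private
      k l ρ : ℕ
      k = suc k₁
      l = suc l₁
      ρ = suc ρ₁

      k≤N : k ≤ N
      k≤N = ≤-trans (≤-reflexive (+-comm 1 k₁)) (≤-trans (+-monoʳ-≤ k₁ (s≤s z≤n)) (≤-reflexive N≡))

    open Concentration N k l ρ g k≤N gap public

    private
      I : Subset N
      I = initial k N

      pivot : Subset (suc N)
      pivot = outside ∷ I

      ∣pivot∣ : ∣ pivot ∣ ≡ k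
      ∣pivot∣ = ∣initial∣ k≤N

      good? : Decidable (λ R → ρ * Y R < k)
      good? R = ρ * Y R <? k

      goods : List (Subset N)
      goods = filter good? (kSubsets N l)

      -- Members through zero are indexed by their complements, so that `Y R` is the number of
      -- points of `I` that the member misses.
      cone : Subset N → Subset (suc N)
      cone R = inside ∷ ∁ R

      cone-injective : ∀ {R S} → cone R ≡ cone S → R ≡ S
      cone-injective {R} {S} eq = trans (sym (∁-involutive R)) (trans (cong ∁ (Vec.∷-injectiveʳ eq)) (∁-involutive S))

      ∣cone∣ : ∀ {R} → ∣ R ∣ ≡ l → ∣ cone R ∣ ≡ k
      ∣cone∣ {R} eq = cong suc (trans (∣∁p∣≡n∸∣p∣ R) (trans (cong₂ _∸_ (sym N≡) eq) (m+n∸n≡m k₁ l)))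

    -- Writing I for the first k points after zero: the set I itself, and the sets containing zero that miss fewer
    -- than k / ρ points of I.  Any ρ of the latter meet inside I.
    family : Family (suc N) k
    family = record
      { members = pivot ∷ map cone goods
      ; unique  = All.tabulate (λ {S} S∈ eq → pivot≢ (∈-map⁻ cone S∈) eq)
                  ∷ Unique.map⁺ cone-injective (Unique.filter⁺ good? (kSubsets-unique N l))
      ; uniform = ∣pivot∣ ∷ All.map⁺ (All.map (λ {R} → ∣cone∣ {R}) (All.filter⁺ good? (∣kSubset∣ N l)))
      }
      where
      pivot≢ : ∀ {S} → ∃[ R ] (R ∈ goods × S ≡ cone R) → pivot ≢ S
      pivot≢ (_ , _ , refl) ()

    private
      deficit : ∀ {S} → S ∈ members family → ρ * ∣ pivot ∩ ∁ S ∣ ≤ k₁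
      deficit (here refl) = ≤-trans (≤-reflexive (trans (cong (ρ *_) (∣A∩∁A∣≡0 pivot)) (*-zeroʳ ρ))) z≤n
      deficit (there S∈)  = go (∈-map⁻ cone S∈)
        where
        go : ∀ {S} → ∃[ R ] (R ∈ goods × S ≡ cone R) → ρ * ∣ pivot ∩ ∁ S ∣ ≤ k₁
        go (R , R∈ , refl) = s≤s⁻¹ (subst (λ z → ρ * ∣ I ∩ z ∣ < k) (sym (∁-involutive R)) (proj₂ (∈-filter⁻ good? {xs = kSubsets N l} R∈)))

      zero∈ : ∀ {S} → S ∈ members family → S ≢ pivot → zero Subset.∈ S
      zero∈ (here refl) S≢pivot = contradiction refl S≢pivot
      zero∈ (there S∈)  S≢pivot = go (∈-map⁻ cone S∈)
        where
        go : ∀ {S} → ∃[ R ] (R ∈ goods × S ≡ cone R) → zero Subset.∈ S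
        go (_ , _ , refl) = Vec.here

    intersecting : Intersecting (suc ρ) family
    intersecting F F∈ with any? (λ i → F i ≟ˢ pivot)
    ... | no none = zero , x∈⋂⁺ (tabulate F) λ S∈ → let i , eq = ∈-tabulate⁻ {f = F} S∈ in
                      subst (zero Subset.∈_) (sym eq) (zero∈ (F∈ i) (λ e → none (i , e)))
    -- By integrality each member costs the pivot at most `k₁ / ρ` points. With the pivot's own
    -- share saved, `ρ` shares remain, so at most `k₁` of its `k` points are lost.
    ... | yes (i , Fi≡pivot) = decidable-stable (nonempty? (⋂ (tabulate F))) λ empty → <⇒≱ {k₁} (s≤s ≤-refl) (begin
        k                           ≡⟨ sym ∣pivot∣ ⟩
        ∣ pivot ∣                       ≤⟨ p⊆q⇒∣p∣≤∣q∣ {p = pivot} {q = pivot ∩ ∁ (⋂ (tabulate F))} (λ x∈ → x∈p∩q⁺ (x∈ , x∉p⇒x∈∁p λ x∈⋂ → empty (_ , x∈⋂))) ⟩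
        ∣ pivot ∩ ∁ (⋂ (tabulate F)) ∣  ≤⟨ *-cancelˡ-≤ ρ (+-cancelˡ-≤ k₁ _ _ (≤-trans
                                         (deficit-bound-∈ {ρ = ρ} pivot (tabulate F) below (subst (_∈ tabulate F) Fi≡pivot (∈-tabulate⁺ {f = F} i)))
                                         (≤-reflexive (cong (_* k₁) (length-tabulate F))))) ⟩
        k₁                          ∎)
      where
      open ≤-Reasoning
      below : ∀ {S} → S ∈ tabulate F → ρ * ∣ pivot ∩ ∁ S ∣ ≤ k₁
      below S∈ = let i , eq = ∈-tabulate⁻ {f = F} S∈ in subst (λ S → ρ * ∣ pivot ∩ ∁ S ∣ ≤ k₁) (sym eq) (deficit (F∈ i))

    nonTrivial : NonTrivial family
    nonTrivial (zero  , x∈) = contradiction (x∈⋂⁻ (members family) x∈ (here refl)) λ ()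
    nonTrivial (suc y , x∈) = x∈∁p⇒x∉p (drop-there (x∈⋂⁻ (members family) x∈ (there (∈-map⁺ cone R∈)))) (q⊆p∪q (∁ I) ⁅ y ⁆ (x∈⁅x⁆ y))
      where
      y∈I : y Subset.∈ I
      y∈I = drop-there (x∈⋂⁻ (members family) x∈ (here refl))
      -- The cone of this `R` misses exactly one point of `I`, namely `y`; a deficit of 1 is allowed
      -- because `ρ < k`.
      R : Subset N
      R = ∁ I ∪ ⁅ y ⁆
      ∣R∣ : ∣ R ∣ ≡ l
      ∣R∣ = trans (∣p∪⁅x⁆∣≡1+∣p∣ (∁ I) (λ y∈ → x∈∁p⇒x∉p y∈ y∈I))
        (cong suc (trans (∣∁p∣≡n∸∣p∣ I) (trans (cong₂ _∸_ (trans (sym N≡) (+-suc k₁ l₁)) (∣initial∣ k≤N)) (m+n∸m≡n k₁ l₁))))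
      meet : I ∩ R Subset.⊆ ⁅ y ⁆
      meet z∈ with x∈p∩q⁻ I R z∈
      ... | z∈I , z∈R with x∈p∪q⁻ (∁ I) ⁅ y ⁆ z∈R
      ...   | inj₁ z∈∁I = contradiction z∈I (x∈∁p⇒x∉p z∈∁I)
      ...   | inj₂ z∈y  = z∈y
      R∈ : R ∈ goods
      R∈ = ∈-filter⁺ good? (subst (λ j → R ∈ kSubsets N j) ∣R∣ (∈-kSubsets R))
        (≤-trans (s≤s (≤-trans (*-monoʳ-≤ ρ (≤-trans (p⊆q⇒∣p∣≤∣q∣ meet) (≤-reflexive (∣⁅x⁆∣≡1 y)))) (≤-reflexive (*-identityʳ ρ)))) ρ<k)

    size-bound : N C k₁ ≤ size family + bad
    size-bound = begin
      N C k₁                        ≡⟨ trans (nCk≡nC[n∸k] (≤-trans (n≤1+n k₁) k≤N)) (cong (N C_) (trans (cong (_∸ k₁) (sym N≡)) (m+n∸m≡n k₁ l))) ⟩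
      N C l                         ≡⟨ sym (trans (∑-const (kSubsets N l) 1) (trans (*-identityʳ _) (length-kSubsets N l))) ⟩
      ∑[ R ∈ kSubsets N l ] 1       ≡⟨ ∑-cong (kSubsets N l) (λ R → split (good? R) (k ≤? ρ * Y R)) ⟩
      ∑[ R ∈ kSubsets N l ] (𝟙 (does (good? R)) + 𝟙 (does (k ≤? ρ * Y R))) ≡⟨ ∑-+ (kSubsets N l) _ _ ⟩
      ∑[ R ∈ kSubsets N l ] 𝟙 (does (good? R)) + bad ≡⟨ cong (_+ bad) (trans (sym (length-filter-∑ good? (kSubsets N l))) (sym (length-map cone goods))) ⟩
      length (map cone goods) + bad ≤⟨ +-monoˡ-≤ bad (n≤1+n _) ⟩
      size family + bad             ∎
      where
      open ≤-Reasoning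
      split : ∀ {a b} (p : Dec (a < b)) (q : Dec (b ≤ a)) → 1 ≡ 𝟙 (does p) + 𝟙 (does q)
      split (yes p) (yes q) = contradiction q (<⇒≱ p)
      split (yes p) (no q)  = refl
      split (no p)  (yes q) = refl
      split (no p)  (no q)  = contradiction (≮⇒≥ p) q

  -- Numerical consequences of the range of `k / n`

  module Arithmetic (ρ₁ E₁ D₁ N k₁ : ℕ) (1≤ρ₁ : 1 ≤ ρ₁) where
    private
      ρ r E D n k : ℕ
      ρ = suc ρ₁
      r = suc ρ
      E = suc E₁
      D = suc D₁
      n = suc N
      k = suc k₁

    open ≤-Reasoning

    -- `E` and `D` are the denominators of unit fractions below ε and δ. `lower` and `upper` say
    -- `ρ₁ / ρ + 1 / E < k / n` and `k / n + 1 / E < ρ / r`.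
    module _ (lower : (ρ₁ * E + ρ) * n < k * (ρ * E))
             (upper : (k * E + n) * r < ρ * (n * E))
             (large : 2 * (D * (ρ * ρ * (E * E))) < n) where

      k<n : k < n
      k<n = *-cancelʳ-< (r * E) k n (begin-strict
        k * (r * E)                 ≤⟨ m≤m+n _ (n * r) ⟩
        k * (r * E) + n * r       ≡⟨ lem k E n r ⟩
        (k * E + n) * r            <⟨ upper ⟩
        ρ * (n * E)                 ≤⟨ *-monoˡ-≤ (n * E) (n≤1+n ρ) ⟩
        r * (n * E)                 ≡⟨ lem′ n E r ⟩
        n * (r * E)                 ∎)
        where
        lem : ∀ k E n r → k * (r * E) + n * r ≡ (k * E + n) * r
        lem = solve-∀
        lem′ : ∀ n E r → r * (n * E) ≡ n * (r * E)
        lem′ = solve-∀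

      l₁ l : ℕ
      l₁ = N ∸ k
      l  = suc l₁

      k₁+l≡N : k₁ + l ≡ N
      k₁+l≡N = trans (+-suc k₁ l₁) (m+[n∸m]≡n (s≤s⁻¹ k<n))

      k+l≡n : k + l ≡ n
      k+l≡n = cong suc k₁+l≡N

      -- `1 ≤ ρ₁`, that is `r ≥ 3`, makes `ρ₁ / ρ` at least one half.
      n<2k : n < 2 * k
      n<2k = *-cancelʳ-< (ρ * E) n (2 * k) (begin-strict
        n * (ρ * E)                      ≤⟨ *-monoʳ-≤ n (*-monoˡ-≤ E (+-monoˡ-≤ ρ₁ 1≤ρ₁)) ⟩
        n * ((ρ₁ + ρ₁) * E)             ≤⟨ m≤m+n _ (2 * (ρ * n)) ⟩
        n * ((ρ₁ + ρ₁) * E) + 2 * (ρ * n) ≡⟨ lem n ρ₁ ρ E ⟩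
        2 * ((ρ₁ * E + ρ) * n)         <⟨ *-monoʳ-< 2 lower ⟩
        2 * (k * (ρ * E))               ≡⟨ sym (*-assoc 2 k _) ⟩
        2 * k * (ρ * E)                 ∎)
        where
        lem : ∀ n p ρ E → n * ((p + p) * E) + 2 * (ρ * n) ≡ 2 * ((p * E + ρ) * n)
        lem = solve-∀

      l<k : l < k
      l<k = +-cancelˡ-< k l k (subst₂ _<_ (sym k+l≡n) (cong (k +_) (+-identityʳ k)) n<2k)

      -- In terms of `l`: `l / n < 1 / ρ − 1 / E`.
      lower-slack : ρ * n + ρ * E * l < E * n
      lower-slack = +-cancelˡ-< (ρ₁ * E * n) _ _ (begin-strict
        ρ₁ * E * n + (ρ * n + ρ * E * l)   ≡⟨ lem₁ ρ₁ ρ E n l ⟩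
        (ρ₁ * E + ρ) * n + l * (ρ * E)      <⟨ +-monoˡ-< (l * (ρ * E)) lower ⟩
        k * (ρ * E) + l * (ρ * E)            ≡⟨ sym (*-distribʳ-+ (ρ * E) k l) ⟩
        (k + l) * (ρ * E)                      ≡⟨ cong (_* (ρ * E)) k+l≡n ⟩
        n * (ρ * E)                             ≡⟨ lem₂ ρ₁ E n ⟩
        ρ₁ * E * n + E * n                    ∎)
        where
        lem₁ : ∀ p ρ E n l → p * E * n + (ρ * n + ρ * E * l) ≡ (p * E + ρ) * n + l * (ρ * E)
        lem₁ = solve-∀
        lem₂ : ∀ p E n → n * (suc p * E) ≡ p * E * n + E * n
        lem₂ = solve-∀

      -- In terms of `l`: `l / n > 1 / r + 1 / E`.
      upper-slack : E * n + n * r < E * (r * l)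
      upper-slack = +-cancelˡ-< (ρ * (n * E)) _ _ (begin-strict
        ρ * (n * E) + (E * n + n * r)       ≡⟨ lem₁ ρ n E ⟩
        n * (E * r) + n * r                   ≡⟨ cong (λ z → z * (E * r) + n * r) (sym k+l≡n) ⟩
        (k + l) * (E * r) + n * r            ≡⟨ lem₂ k l E r n ⟩
        (k * E + n) * r + E * (r * l)       <⟨ +-monoˡ-< (E * (r * l)) upper ⟩
        ρ * (n * E) + E * (r * l)            ∎)
        where
        lem₁ : ∀ ρ n E → ρ * (n * E) + (E * n + n * suc ρ) ≡ n * (E * suc ρ) + n * suc ρ
        lem₁ = solve-∀
        lem₂ : ∀ k l E r n → (k + l) * (E * r) + n * r ≡ (k * E + n) * r + E * (r * l)
        lem₂ = solve-∀

      K₀ : ℕ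
      K₀ = D * (ρ * ρ * (E * E))

      K₀<k : K₀ < k
      K₀<k = *-cancelˡ-< 2 K₀ k (<-trans large n<2k)

      ρ<k : ρ < k
      ρ<k = ≤-<-trans (≤-trans (m≤m*n ρ ρ) (≤-trans (m≤m*n (ρ * ρ) (E * E)) (m≤n*m _ D))) K₀<k

      E≤n : E ≤ n
      E≤n = <⇒≤ (≤-<-trans (≤-trans (m≤m*n E E) (≤-trans (m≤n*m (E * E) (ρ * ρ)) (m≤n*m _ D))) (<-trans K₀<k k<n))

      -- As `N` is `n − 1`, rounding down makes `suc q` equal to ⌈n / r⌉.
      q : ℕ
      q = N / r

      rq<n : r * q < n
      rq<n = s≤s (≤-trans (≤-reflexive (*-comm r q)) (m/n*n≤m N r))

      n≤r[1+q] : n ≤ r * suc q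
      n≤r[1+q] = begin
        suc N                          ≡⟨ cong suc (m≡m%n+[m/n]*n N r) ⟩
        suc (N % r) + q * r         ≤⟨ +-monoˡ-≤ (q * r) (m%n<n N r) ⟩
        suc q * r                     ≡⟨ *-comm (suc q) r ⟩
        r * suc q                     ∎

      -- By `E≤n` the surplus `n / E` of `l` over `n / r` is at least 1, which pays for the rounding
      -- up.
      1+q<l : suc q < l
      1+q<l = *-cancelˡ-< r (suc q) l (begin-strict
        r * suc q          ≡⟨ *-suc r q ⟩
        r + r * q         ≤⟨ +-monoʳ-≤ r (<⇒≤ rq<n) ⟩
        r + n              <⟨ *-cancelˡ-< E (r + n) (r * l) (begin-strict
            E * (r + n)      ≡⟨ trans (*-distribˡ-+ E r n) (+-comm (E * r) (E * n)) ⟩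
            E * n + E * r   ≤⟨ +-monoʳ-≤ (E * n) (*-monoˡ-≤ r E≤n) ⟩
            E * n + n * r   <⟨ upper-slack ⟩
            E * (r * l)      ∎) ⟩
        r * l              ∎)

      excess : ℕ
      excess = l ∸ suc (suc q)

      l-split : suc q + suc excess ≡ l
      l-split = trans (+-suc (suc q) excess) (m+[n∸m]≡n 1+q<l)

      ρl<n : ρ * l < n
      ρl<n = *-cancelˡ-< E (ρ * l) n (begin-strict
        E * (ρ * l)                ≡⟨ lem E ρ l ⟩
        ρ * E * l                  ≤⟨ m≤n+m _ (ρ * n) ⟩
        ρ * n + ρ * E * l        <⟨ lower-slack ⟩
        E * n                       ∎)
        where
        lem : ∀ E ρ l → E * (ρ * l) ≡ ρ * E * l
        lem = solve-∀

      g : ℕ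
      g = N ∸ ρ * l

      ρl+g≡N : ρ * l + g ≡ N
      ρl+g≡N = m+[n∸m]≡n (s≤s⁻¹ ρl<n)

      -- `lower-slack` reads `ρ * n < E * g + E`, the last `E` coming from `N = n − 1`. Since
      -- `ρ ≥ 2`, one copy of `n` pays for it.
      n≤Eg : n ≤ E * g
      n≤Eg = <⇒≤ (+-cancelʳ-< n n (E * g) (begin-strict
        n + n              ≤⟨ +-monoʳ-≤ n (m≤n*m n ρ₁ {{>-nonZero 1≤ρ₁}}) ⟩
        ρ * n              <⟨ +-cancelʳ-< (ρ * E * l) (ρ * n) (E * g + E) (begin-strict
            ρ * n + ρ * E * l     <⟨ lower-slack ⟩
            E * n                    ≡⟨ cong (λ z → E * suc z) (sym ρl+g≡N) ⟩
            E * suc (ρ * l + g)    ≡⟨ lem E ρ l g ⟩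
            E * g + E + ρ * E * l ∎) ⟩
        E * g + E         ≤⟨ +-monoʳ-≤ (E * g) E≤n ⟩
        E * g + n         ∎))
        where
        lem : ∀ E ρ l g → E * suc (ρ * l + g) ≡ E * g + E + ρ * E * l
        lem = solve-∀

      -- With `g ≥ n / E`, Chebyshev leaves a bad fraction of at most `ρ * ρ * (E * E) / k`, and
      -- `K₀ < k` brings it below `1 / D`.
      few-bad : ∀ {bad c} → (k * g) * (k * g) * bad ≤ ρ * ρ * N * k * l * c → D * bad ≤ c
      few-bad {bad} {c} cheb = *-cancelˡ-≤ (ρ * ρ * (E * E)) (begin
        ρ * ρ * (E * E) * (D * bad)   ≡⟨ lem₀ (ρ * ρ * (E * E)) D bad ⟩
        K₀ * bad                           ≤⟨ *-monoˡ-≤ bad (<⇒≤ K₀<k) ⟩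
        k * bad                           ≤⟨ *-cancelˡ-≤ (k * (n * n)) (begin
            k * (n * n) * (k * bad)                       ≤⟨ *-monoˡ-≤ (k * bad) (*-monoʳ-≤ k (*-mono-≤ n≤Eg n≤Eg)) ⟩
            k * (E * g * (E * g)) * (k * bad)           ≡⟨ lem₁ k E g bad ⟩
            E * E * ((k * g) * (k * g) * bad)           ≤⟨ *-monoʳ-≤ (E * E) cheb ⟩
            E * E * (ρ * ρ * N * k * l * c)            ≡⟨ lem₂ E ρ N k l c ⟩
            k * (N * l) * (ρ * ρ * (E * E) * c)        ≤⟨ *-monoˡ-≤ (ρ * ρ * (E * E) * c) (*-monoʳ-≤ k (*-mono-≤ (n≤1+n N) (≤-trans (m≤n+m l k) (≤-reflexive k+l≡n)))) ⟩
            k * (n * n) * (ρ * ρ * (E * E) * c)        ∎) ⟩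
        ρ * ρ * (E * E) * c            ∎)
        where
        lem₀ : ∀ w D b → w * (D * b) ≡ D * w * b
        lem₀ = solve-∀
        lem₁ : ∀ k E g b → k * (E * g * (E * g)) * (k * b) ≡ E * E * ((k * g) * (k * g) * b)
        lem₁ = solve-∀
        lem₂ : ∀ E ρ N k l c → E * E * (ρ * ρ * N * k * l * c) ≡ k * (N * l) * (ρ * ρ * (E * E) * c)
        lem₂ = solve-∀

      maximum-bounds : ∃[ m ] (IsM r n k m × D * (N C k₁) ≤ D * m + (N C k₁) × m < N C k₁)
      maximum-bounds =
        let 𝓜 , (int , nt) , max = maximum-exists r HM.family (HM.intersecting , HM.nonTrivial) in
        size 𝓜 , ((𝓜 , (int , nt) , refl) , max) , close (max HM.family (HM.intersecting , HM.nonTrivial)) ,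
        Katona.size<star N k₁ l r q excess k+l≡n l<k l-split rq<n n≤r[1+q] 𝓜 int nt
        where
        module HM = HiltonMilner N k₁ l₁ ρ₁ g k₁+l≡N ρ<k ρl+g≡N
        same-C : N C l ≡ N C k₁
        same-C = sym (trans (nCk≡nC[n∸k] (m+n≤o⇒m≤o k₁ (≤-reflexive k₁+l≡N)))
          (cong (N C_) (trans (cong (_∸ k₁) (sym k₁+l≡N)) (m+n∸m≡n k₁ l))))
        close : ∀ {m} → size HM.family ≤ m → D * (N C k₁) ≤ D * m + (N C k₁)
        close {m} le = begin
          D * (N C k₁)                       ≤⟨ *-monoʳ-≤ D HM.size-bound ⟩
          D * (size HM.family + HM.bad)     ≡⟨ *-distribˡ-+ D (size HM.family) HM.bad ⟩
          D * size HM.family + D * HM.bad  ≤⟨ +-mono-≤ (*-monoʳ-≤ D le) (few-bad HM.chebyshev) ⟩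
          D * m + (N C l)                   ≡⟨ cong (D * m +_) same-C ⟩
          D * m + (N C k₁)                  ∎

-- Between rational and natural inequalities

open FiniteFamilies

open import Data.Integer using (+_)
import Data.Integer as ℤ
import Data.Integer.Properties as ℤ
open import Data.Nat using (zero; suc; z≤n; s≤s) renaming (_+_ to _+ℕ_; _*_ to _*ℕ_)
import Data.Nat.Properties as ℕ
open import Data.Nat.Tactic.RingSolver using (solve-∀)
open import Data.Product using (_,_; proj₁; proj₂)
open import Data.Rational using (ℚ; mkℚ; 0ℚ; 1ℚ; _/_; _+_; _-_; -_; _*_; _≤_; _<_; *<*; toℚᵘ)
import Data.Rational.Properties as ℚ
open import Data.Rational.Unnormalised using (mkℚᵘ) renaming (_<_ to _<ᵘ_; _+_ to _+ᵘ_; _*_ to _*ᵘ_; *≤* to *≤*ᵘ; _≃_ to _≃ᵘ_)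
import Data.Rational.Unnormalised.Properties as ℚᵘ
open import Relation.Binary.PropositionalEquality using (_≡_; refl; sym; trans; cong; cong₂; subst; subst₂)

reciprocal-below : ∀ ε → 0ℚ < ε → ∃[ e ] + 1 / suc e ≤ ε
reciprocal-below (mkℚ (+ zero)   e c) (*<* (ℤ.+<+ ()))
reciprocal-below (mkℚ ℤ.-[1+ a ] e c) (*<* ())
reciprocal-below ε@(mkℚ (+ suc a) e c) _ = e , ℚ.toℚᵘ-cancel-≤ (ℚᵘ.≤-trans
  (ℚᵘ.≤-reflexive (ℚ.toℚᵘ-fromℚᵘ (mkℚᵘ (+ 1) e)))
  (*≤*ᵘ (ℤ.+≤+ (ℕ.*-monoˡ-≤ (suc e) {1} {suc a} (s≤s z≤n)))))

/-+-<⁻ : ∀ a b e c d → + a / suc b + + 1 / suc e < + c / suc d → (a *ℕ suc e +ℕ suc b) *ℕ suc d <ℕ c *ℕ (suc b *ℕ suc e)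
/-+-<⁻ a b e c d lt = ℤ.drop‿+<+ (subst₂ ℤ._<_ lhs (sym (ℤ.pos-* c (suc b *ℕ suc e))) (ℚᵘ.drop-*<* unnormalised))
  where
  unnormalised : mkℚᵘ (+ a) b +ᵘ mkℚᵘ (+ 1) e <ᵘ mkℚᵘ (+ c) d
  unnormalised = ℚᵘ.<-respʳ-≃ (ℚ.toℚᵘ-fromℚᵘ (mkℚᵘ (+ c) d)) (ℚᵘ.<-respˡ-≃
    (ℚᵘ.≃-trans (ℚ.toℚᵘ-homo-+ (+ a / suc b) (+ 1 / suc e)) (ℚᵘ.+-cong (ℚ.toℚᵘ-fromℚᵘ (mkℚᵘ (+ a) b)) (ℚ.toℚᵘ-fromℚᵘ (mkℚᵘ (+ 1) e))))
    (ℚ.toℚᵘ-mono-< lt))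
  lhs : (+ a ℤ.* + suc e ℤ.+ + 1 ℤ.* + suc b) ℤ.* + suc d ≡ + ((a *ℕ suc e +ℕ suc b) *ℕ suc d)
  lhs = trans (cong (ℤ._* + suc d) (cong₂ ℤ._+_ (sym (ℤ.pos-* a (suc e))) (ℤ.*-identityˡ (+ suc b)))) (sym (ℤ.pos-* (a *ℕ suc e +ℕ suc b) (suc d)))

≤+reciprocal* : ∀ c m d → suc d *ℕ c ≤ℕ suc d *ℕ m +ℕ c → + c / 1 ≤ + m / 1 + + 1 / suc d * (+ c / 1)
≤+reciprocal* c m d le = ℚ.toℚᵘ-cancel-≤ (ℚᵘ.≤-respˡ-≃ (ℚᵘ.≃-sym (ℚ.toℚᵘ-fromℚᵘ (mkℚᵘ (+ c) 0)))
  (ℚᵘ.≤-respʳ-≃ (ℚᵘ.≃-sym rhs) (*≤*ᵘ (subst₂ ℤ._≤_ eqˡ eqʳ (ℤ.+≤+ le)))))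
  where
  rhs : toℚᵘ (+ m / 1 + + 1 / suc d * (+ c / 1)) ≃ᵘ mkℚᵘ (+ m) 0 +ᵘ mkℚᵘ (+ 1) d *ᵘ mkℚᵘ (+ c) 0
  rhs = ℚᵘ.≃-trans (ℚ.toℚᵘ-homo-+ (+ m / 1) _) (ℚᵘ.+-cong (ℚ.toℚᵘ-fromℚᵘ (mkℚᵘ (+ m) 0))
    (ℚᵘ.≃-trans (ℚ.toℚᵘ-homo-* (+ 1 / suc d) (+ c / 1)) (ℚᵘ.*-cong (ℚ.toℚᵘ-fromℚᵘ (mkℚᵘ (+ 1) d)) (ℚ.toℚᵘ-fromℚᵘ (mkℚᵘ (+ c) 0)))))
  eqˡ : + (suc d *ℕ c) ≡ + c ℤ.* + (1 *ℕ (suc d *ℕ 1))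
  eqˡ = trans (cong (λ z → + z) (lem c d)) (ℤ.pos-* c (1 *ℕ (suc d *ℕ 1)))
    where
    lem : ∀ c d → suc d *ℕ c ≡ c *ℕ (1 *ℕ (suc d *ℕ 1))
    lem = solve-∀
  eqʳ : + (suc d *ℕ m +ℕ c) ≡ (+ m ℤ.* + (suc d *ℕ 1) ℤ.+ + 1 ℤ.* + c ℤ.* + 1) ℤ.* + 1
  eqʳ = sym (trans (ℤ.*-identityʳ _) (trans (cong₂ ℤ._+_ (sym (ℤ.pos-* m (suc d *ℕ 1))) (trans (ℤ.*-identityʳ _) (ℤ.*-identityˡ (+ c)))) (cong (λ z → + z) (lem m d c))))
    where
    lem : ∀ m d c → m *ℕ (suc d *ℕ 1) +ℕ c ≡ suc d *ℕ m +ℕ c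
    lem = solve-∀

+-cancelʳ-≤ : ∀ p q r → p + r ≤ q + r → p ≤ q
+-cancelʳ-≤ p q r le = subst₂ _≤_ (undo p) (undo q) (ℚ.+-monoˡ-≤ (- r) le)
  where
  undo : ∀ p → p + r + - r ≡ p
  undo p = trans (ℚ.+-assoc p r (- r)) (trans (cong (λ z → p + z) (ℚ.+-inverseʳ r)) (ℚ.+-identityʳ p))

-- `δ * c` is moved to the right, where raising `1 / suc d` to `δ` can only help; the sign of
-- `1 − δ` never matters.
[1-δ]*c≤m : ∀ {δ} d c m → + 1 / suc d ≤ δ → suc d *ℕ c ≤ℕ suc d *ℕ m +ℕ c → (1ℚ - δ) * (+ c / 1) ≤ + m / 1
[1-δ]*c≤m {δ} d c m d≤δ le = +-cancelʳ-≤ _ _ (δ * C/1) (begin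
  (1ℚ - δ) * C/1 + δ * C/1          ≡⟨ sym (ℚ.*-distribʳ-+ C/1 (1ℚ - δ) δ) ⟩
  (1ℚ - δ + δ) * C/1                ≡⟨ cong (_* C/1) (trans (ℚ.+-assoc 1ℚ (- δ) δ) (trans (cong (λ z → 1ℚ + z) (ℚ.+-inverseˡ δ)) (ℚ.+-identityʳ 1ℚ))) ⟩
  1ℚ * C/1                          ≡⟨ ℚ.*-identityˡ C/1 ⟩
  C/1                               ≤⟨ ≤+reciprocal* c m d le ⟩
  + m / 1 + + 1 / suc d * C/1       ≤⟨ ℚ.+-monoʳ-≤ (+ m / 1) (ℚ.*-monoʳ-≤-nonNeg C/1 {{ℚ.normalize-nonNeg c 1}} d≤δ) ⟩
  + m / 1 + δ * C/1                 ∎)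
  where
  open ℚ.≤-Reasoning
  C/1 = + c / 1

theorem12 :
    (r : ℕ) (3≤r : 3 ≤ℕ r) →
    let instance
          r≢0 = 3≤⇒nonZero 3≤r
          r-1≢0 = 3≤⇒pred-nonZero 3≤r
    in
    (ε : ℚ) → 0ℚ < ε → (δ : ℚ) → 0ℚ < δ →
    ∃[ n₀ ] ((n k : ℕ) (n₀<n : n₀ <ℕ n) →
      let instance n≢0 = >⇒nonZero n₀<n in
      + (r ∸ 2) / (r ∸ 1) + ε < + k / n →
      + k / n < + (r ∸ 1) / r - ε →
      ∃[ m ] (IsM r n k m ×
        (1ℚ - δ) * (+ ((n ∸ 1) C (k ∸ 1)) / 1) ≤ + m / 1 ×
        m <ℕ (n ∸ 1) C (k ∸ 1)))
theorem12 (suc (suc (suc r₁))) (s≤s (s≤s (s≤s _))) ε 0<ε δ 0<δ = n₀ , bounds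
  where
  ρ₁ ρ r E₁ D₁ n₀ : ℕ
  ρ₁ = suc r₁
  ρ  = suc ρ₁
  r  = suc ρ
  E₁ = proj₁ (reciprocal-below ε 0<ε)
  D₁ = proj₁ (reciprocal-below δ 0<δ)
  -- Twice the value that `k` must exceed in `few-bad`; `n < 2 * k` passes the bound on from `n` to
  -- `k`.
  n₀ = 2 *ℕ (suc D₁ *ℕ (ρ *ℕ ρ *ℕ (suc E₁ *ℕ suc E₁)))
  1/E≤ε = proj₂ (reciprocal-below ε 0<ε)

  lower : ∀ N k → + ρ₁ / ρ + ε < + k / suc N → (ρ₁ *ℕ suc E₁ +ℕ ρ) *ℕ suc N <ℕ k *ℕ (ρ *ℕ suc E₁)
  lower N k lt = /-+-<⁻ ρ₁ ρ₁ E₁ k N (ℚ.≤-<-trans (ℚ.+-monoʳ-≤ (+ ρ₁ / ρ) 1/E≤ε) lt)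

  upper : ∀ N k → + k / suc N < + ρ / r - ε → (k *ℕ suc E₁ +ℕ suc N) *ℕ r <ℕ ρ *ℕ (suc N *ℕ suc E₁)
  upper N k lt = /-+-<⁻ k N E₁ ρ ρ (ℚ.≤-<-trans (ℚ.+-monoʳ-≤ (+ k / suc N) 1/E≤ε)
    (subst (+ k / suc N + ε <_) (trans (ℚ.+-assoc (+ ρ / r) (- ε) ε) (trans (cong (λ z → + ρ / r + z) (ℚ.+-inverseˡ ε)) (ℚ.+-identityʳ (+ ρ / r))))
      (ℚ.+-monoˡ-< ε lt)))

  bounds : (n k : ℕ) (n₀<n : n₀ <ℕ n) →
    let instance n≢0 = >⇒nonZero n₀<n in
    + ρ₁ / ρ + ε < + k / n → + k / n < + ρ / r - ε →
    ∃[ m ] (IsM r n k m × (1ℚ - δ) * (+ ((n ∸ 1) C (k ∸ 1)) / 1) ≤ + m / 1 × m <ℕ (n ∸ 1) C (k ∸ 1))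
  bounds (suc N) zero     n₀<n low up with () ← lower N zero low
  bounds (suc N) (suc k₁) n₀<n low up =
    let m , isM , close , below = Arithmetic.maximum-bounds ρ₁ E₁ D₁ N k₁ (s≤s z≤n) (lower N (suc k₁) low) (upper N (suc k₁) up) n₀<n
    in m , isM , [1-δ]*c≤m D₁ (N C k₁) m (proj₂ (reciprocal-below δ 0<δ)) close , below
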